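{- Let $H\in\{\text{house},\text{hammer},\text{diamond}\}$ and let $\mathcal{C}$ be the class of $(\text{bull},H)$-free graphs. Then $\mathcal{C}$ is perfect-Pollyanna.
   Context: Graphs are finite and simple; $G$ is $(F_1,F_2)$-free if it has no induced subgraph isomorphic to $F_1$ or $F_2$. A bull is a triangle with two disjoint pendant edges. A house is the complement of the path $P_5$. A hammer is obtained by identifying an end vertex of a path $P_3$ with a vertex of a triangle. A diamond is two triangles sharing exactly one edge ($K_4$ minus an edge). A graph is perfect if $\chi(H)=\omega(H)$ for all induced subgraphs $H$. $G$ is perfectly divisible if for every induced subgraph $H$ of $G$, $V(H)$ can be partitioned into $A,B$ with $H[A]$ perfect and $\omega(H[B])<\omega(H)$. A class is hereditary if it is closed under isomorphism and taking induced subgraphs. A class $\mathcal{C}$ is perfect-Pollyanna if $\mathcal{C}\cap\mathcal{G}$ is perfectly divisible (every member is perfectly divisible) for every hereditary class $\mathcal{G}$ in which every triangle-free graph is $3$-colorable. -}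

module Defs where

open import Data.Nat using (ℕ; zero; suc; _<_; _≤_)
open import Data.Fin using (Fin; zero; suc)
open import Data.Fin.Properties using (_≟_)
open import Data.Bool using (Bool; true; false; not; _∨_; if_then_else_)
open import Data.Bool.Properties using (∨-comm)
open import Data.Vec using (Vec; []; _∷_; map)
open import Data.Product using (Σ; _×_; _,_)
open import Function.Definitions using (Injective)
open import Relation.Nullary using (¬_; yes; no)
open import Relation.Binary.PropositionalEquality using (_≡_; _≢_; refl; sym)
open import Level using () renaming (suc to lsuc; zero to lzero)

record Graph (n : ℕ) : Set where
  field
    adj    : Fin n → Fin n → Bool
    adj-sym : ∀ i j → adj i j ≡ adj j i
    adj-irr : ∀ i → adj i i ≡ false
open Graph public

mkGraph : ∀ {n} → (Fin n → Fin n → Bool) → Graph n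
mkGraph {n} e = record { adj = a ; adj-sym = s ; adj-irr = r }
  where
  a : Fin n → Fin n → Bool
  a i j with i ≟ j
  ... | yes _ = false
  ... | no _  = e i j ∨ e j i
  s : ∀ i j → a i j ≡ a j i
  s i j with i ≟ j | j ≟ i
  ... | yes _ | yes _ = refl
  ... | yes p | no q  = Relation.Nullary.contradiction (sym p) q
  ... | no p  | yes q = Relation.Nullary.contradiction (sym q) p
  ... | no _  | no _  = ∨-comm (e i j) (e j i)
  r : ∀ i → a i i ≡ false
  r i with i ≟ i
  ... | yes _ = refl
  ... | no p  = Relation.Nullary.contradiction refl p

record _≤ᵢ_ {m n : ℕ} (H : Graph m) (G : Graph n) : Set where
  field
    emb      : Fin m → Fin n
    emb-inj  : Injective _≡_ _≡_ emb
    emb-adj  : ∀ i j → adj H i j ≡ adj G (emb i) (emb j)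

Free : ∀ {k n} → Graph k → Graph n → Set
Free F G = ¬ (F ≤ᵢ G)

count : ∀ {n} → Vec Bool n → ℕ
count []          = zero
count (true ∷ s)  = suc (count s)
count (false ∷ s) = count s

select : ∀ {n} (s : Vec Bool n) → Fin (count s) → Fin n
select (true ∷ s) zero    = zero
select (true ∷ s) (suc i) = suc (select s i)
select (false ∷ s) i      = suc (select s i)

induce : ∀ {n} → Graph n → (s : Vec Bool n) → Graph (count s)
induce G s = record
  { adj = λ i j → adj G (select s i) (select s j)
  ; adj-sym = λ i j → adj-sym G (select s i) (select s j)
  ; adj-irr = λ i → adj-irr G (select s i) }

HasClique : ∀ {n} → Graph n → ℕ → Set
HasClique {n} G k = Σ (Fin k → Fin n) λ f → ∀ i j → i ≢ j → adj G (f i) (f j) ≡ true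

IsCliqueNumber : ∀ {n} → Graph n → ℕ → Set
IsCliqueNumber G k = HasClique G k × ¬ HasClique G (suc k)

Colorable : ∀ {n} → Graph n → ℕ → Set
Colorable {n} G k = Σ (Fin n → Fin k) λ c → ∀ i j → adj G i j ≡ true → c i ≢ c j

IsChromaticNumber : ∀ {n} → Graph n → ℕ → Set
IsChromaticNumber G k = Colorable G k × (∀ j → Colorable G j → k ≤ j)

Perfect : ∀ {n} → Graph n → Set
Perfect G = ∀ {m} (H : Graph m) → H ≤ᵢ G → ∀ k → IsCliqueNumber H k → IsChromaticNumber H k

PerfectlyDivisible : ∀ {n} → Graph n → Set
PerfectlyDivisible G =
  ∀ {m} (H : Graph m) → H ≤ᵢ G → 0 < m →
    Σ (Vec Bool m) λ s →
      Perfect (induce H s) ×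
      (∀ k l → IsCliqueNumber H k → IsCliqueNumber (induce H (map not s)) l → l < k)

Class : Set₁
Class = ∀ {n} → Graph n → Set

Hereditary : Class → Set
Hereditary 𝒢 = ∀ {m n} (H : Graph m) (G : Graph n) → H ≤ᵢ G → 𝒢 G → 𝒢 H

triangle : Graph 3
triangle = mkGraph (λ _ _ → true)

TriangleFree : ∀ {n} → Graph n → Set
TriangleFree G = Free triangle G

-- bull: triangle 0 1 2, pendant edges 0-3 and 1-4
bullE : Fin 5 → Fin 5 → Bool
bullE zero (suc zero) = true
bullE zero (suc (suc zero)) = true
bullE (suc zero) (suc (suc zero)) = true
bullE zero (suc (suc (suc zero))) = true
bullE (suc zero) (suc (suc (suc (suc zero)))) = true
bullE _ _ = false

bull : Graph 5
bull = mkGraph bullE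

-- P5 : 0-1-2-3-4 ; house = complement of P5 (edges 02 03 04 13 14 24)
houseE : Fin 5 → Fin 5 → Bool
houseE zero (suc (suc zero)) = true
houseE zero (suc (suc (suc zero))) = true
houseE zero (suc (suc (suc (suc zero)))) = true
houseE (suc zero) (suc (suc (suc zero))) = true
houseE (suc zero) (suc (suc (suc (suc zero)))) = true
houseE (suc (suc zero)) (suc (suc (suc (suc zero)))) = true
houseE _ _ = false

house : Graph 5
house = mkGraph houseE

-- hammer: triangle 0 1 2 and path 2-3-4
hammerE : Fin 5 → Fin 5 → Bool
hammerE zero (suc zero) = true
hammerE zero (suc (suc zero)) = true
hammerE (suc zero) (suc (suc zero)) = true
hammerE (suc (suc zero)) (suc (suc (suc zero))) = true
hammerE (suc (suc (suc zero))) (suc (suc (suc (suc zero)))) = true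
hammerE _ _ = false

hammer : Graph 5
hammer = mkGraph hammerE

diamondE : Fin 4 → Fin 4 → Bool
diamondE zero (suc zero) = false
diamondE (suc zero) zero = false
diamondE _ _ = true

diamond : Graph 4
diamond = mkGraph diamondE

data HChoice : Set where
  isHouse isHammer isDiamond : HChoice

hSize : HChoice → ℕ
hSize isHouse   = 5
hSize isHammer  = 5
hSize isDiamond = 4

hGraph : (h : HChoice) → Graph (hSize h)
hGraph isHouse   = house
hGraph isHammer  = hammer
hGraph isDiamond = diamond

BullHFree : HChoice → Class
BullHFree h G = Free bull G × Free (hGraph h) G

PerfectPollyanna : Class → Set₁
PerfectPollyanna 𝒞 =
  (𝒢 : Class) → Hereditary 𝒢 →
  (∀ {n} (G : Graph n) → 𝒢 G → TriangleFree G → Colorable G 3) →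
  ∀ {n} (G : Graph n) → 𝒞 G → 𝒢 G → PerfectlyDivisible G

{-# OPTIONS --safe #-}

-- Give the vertices positive weights and divide by induction on the number of vertices: a proper module
-- is contracted to a single vertex carrying the weight of its heaviest clique, so only prime graphs G
-- matter.  Suppose some triangle abc of a prime G is fat: each of its vertices has a neighbour outside
-- it.  Then a together with its non-neighbours is the perfect part; by substitution it suffices that no
-- prime non-bipartite F is anticomplete to a, and this is where bull and H enter.  Without a fat
-- triangle, deleting the thin vertices (degree two, in a triangle) leaves a triangle-free graph of the
-- class 𝒢, and its 3-colouring extends to G.
--
-- For the house and the hammer, no centre of F (vertex complete to F) is adjacent to an anticentre
-- (vertex anticomplete to F), so a neighbour of an anticentre sees a stable part of F.  Without
-- hammers, anticompleteness to F then spreads from a to all of G.  Without houses, vertex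
-- neighbourhoods in G are connected, F is triangle-free, and vertices adjacent to a vertex of F but
-- otherwise alike on F would span a module.  If u sees s in F and an anticentre v, the neighbours of s
-- that see v and the same part of F as u form a component of N(s) avoiding F, a contradiction.
-- Without diamonds, a fat triangle makes G a union of two cliques.
module Submission where

open import Axiom.UniquenessOfIdentityProofs.WithK using (uip)
open import Data.Bool as Bool using (Bool; true; false; not; _∧_; _∨_; if_then_else_)
open import Data.Bool.Properties using (∨-zeroʳ; ¬-not)
open import Data.Empty using (⊥; ⊥-elim)
open import Data.Fin as Fin using (Fin; zero; suc; toℕ; inject≤)
open import Data.Fin.Properties as Fin using (any?; all?)
open import Data.Fin.Subset.Properties using (anySubset?)
open import Data.Maybe as Maybe using (Maybe; just; nothing; maybe′)
open import Data.Nat using (ℕ; zero; suc; _+_; _∸_; _≤_; _<_; z≤n; s≤s; _≤?_; _<?_)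
open import Data.Nat.Properties using
  ( +-0-commutativeMonoid; +-comm; +-identityʳ; +-mono-≤; +-mono-<-≤; +-mono-≤-<; +-monoʳ-≤; +-monoʳ-<
  ; 0∸n≡0; m∸[m∸n]≡n; m≤m+n; m≤n+m; m≤n+m∸n; <-irrefl; ≤-antisym; ≤-pred; ≤-refl; ≤-reflexive; ≤-trans
  ; ≮⇒≥; ≰⇒>; module ≤-Reasoning )
open import Data.Product using (Σ; ∃; ∃₂; _×_; _,_; proj₁; proj₂)
open import Data.Sum using (_⊎_; inj₁; inj₂)
open import Data.Unit using (⊤; tt)
open import Data.Vec as Vec using (Vec; []; _∷_; lookup; tabulate)
open import Data.Vec.Properties using (lookup∘tabulate; lookup-map)
open import Function using (_∘_; id)
open import Function.Definitions using (Injective)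
open import Relation.Binary.PropositionalEquality using
  (_≡_; _≢_; refl; sym; trans; cong; cong₂; subst; subst₂)
open import Relation.Nullary using (¬_; Dec; yes; no; does; contradiction)
open import Relation.Nullary.Decidable using
  (decidable-stable; ¬?; ¬¬-excluded-middle; dec-true; from-yes; _×-dec_; _⊎-dec_; _→-dec_)
open import Algebra.Properties.CommutativeMonoid.Sum +-0-commutativeMonoid using (sum; ∑-distrib-+)

open import Defs

-- The structural contradictions are of three kinds: a forbidden induced subgraph, a proper module
-- of the prime graph `G` or of the prime graph `F`, and a bipartition of `F`. The sets tested for
-- being modules (components, closures, classes of vertices alike on `F`) are often generated
-- inductively and not decidable. As the goal is `⊥`, primality, connectedness and non-bipartiteness
-- are refutations over arbitrary predicates, and excluded middle is available under double
-- negation; only the passage to finite graphs replaces predicates by Boolean vectors.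
--
-- Weights are forced by contraction: one vertex can stand for a module in every clique comparison
-- only if it carries the weight of the module's heaviest clique. For the same reason perfection is
-- demanded for all weightings at once, the form that passes through substitution. Taking `a` and
-- its non-neighbours as the perfect part is enough because a clique outside it lies in the
-- neighbourhood of `a` and becomes heavier when `a` is added.

-- Prime graphs and components on arbitrary vertex types

record Gr : Set₁ where
  infix 4 _~_ _~?_ _≟_
  field
    V     : Set
    _~_   : V → V → Set
    _~?_  : ∀ x y → Dec (x ~ y)
    ~-sym : ∀ {x y} → x ~ y → y ~ x
    ~-irr : ∀ {x} → ¬ x ~ x
    _≟_   : (x y : V) → Dec (x ≡ y)

  ≁-sym : ∀ {x y} → ¬ x ~ y → ¬ y ~ x
  ≁-sym n e = n (~-sym e)

  ~⇒≢ : ∀ {x y} → x ~ y → x ≢ y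
  ~⇒≢ e refl = ~-irr e

  ~-stable : ∀ {x y} → ¬ ¬ x ~ y → x ~ y
  ~-stable {x} {y} = decidable-stable (x ~? y)

  Unmixed : (V → Set) → Set
  Unmixed P = ∀ {z x y} → ¬ P z → P x → P y → z ~ x → ¬ z ~ y → ⊥

  Prime : Set₁
  Prime = (P : V → Set) → ∀ {a b c} → a ≢ b → P a → P b → ¬ P c → Unmixed P → ⊥

  NonBipartite : Set₁
  NonBipartite = (P : V → Set) → (∀ {x y} → x ~ y → P x → P y → ⊥) →
                 (∀ {x y} → x ~ y → ¬ P x → ¬ P y → ⊥) → ⊥

  Connected : Set₁
  Connected = (P : V → Set) → (∀ {x y} → x ~ y → P x → ¬ P y → ⊥) → ∀ {a c} → P a → ¬ P c → ⊥

  Coconnected : Set₁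
  Coconnected = (P : V → Set) → (∀ {x y} → ¬ x ~ y → P x → ¬ P y → ⊥) → ∀ {a c} → P a → ¬ P c → ⊥

  BullFree : Set
  BullFree = ∀ {a b c d e} → a ~ b → a ~ c → b ~ c → a ~ d → b ~ e →
             ¬ c ~ d → ¬ c ~ e → ¬ a ~ e → ¬ b ~ d → ¬ d ~ e → ⊥

  -- r is the roof on the edge ab of the square abcd.
  HouseFree : Set
  HouseFree = ∀ {a b c d r} → a ~ b → b ~ c → c ~ d → d ~ a → r ~ a → r ~ b →
              ¬ a ~ c → ¬ b ~ d → ¬ r ~ c → ¬ r ~ d → ⊥

  HammerFree : Set
  HammerFree = ∀ {a b c d e} → a ~ b → a ~ c → b ~ c → c ~ d → d ~ e →
               ¬ a ~ d → ¬ b ~ d → ¬ a ~ e → ¬ b ~ e → ¬ c ~ e → ⊥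

  DiamondFree : Set
  DiamondFree = ∀ {x y a b} → a ~ b → x ~ a → x ~ b → y ~ a → y ~ b → x ≢ y → ¬ x ~ y → ⊥

  NoTriangleAt : V → Set
  NoTriangleAt a = ∀ {b c} → a ~ b → a ~ c → b ~ c → ⊥

  -- Non-bipartiteness puts an edge on one side of the cut. That side then has two vertices, and
  -- since nothing crosses the cut it is a proper module. The same works for coconnectedness, where
  -- everything crosses.
  prime⇒connected : Prime → NonBipartite → Connected
  prime⇒connected pr nb P cut pa ¬pc = nb P
    (λ e px py → pr P (~⇒≢ e) px py ¬pc λ ¬pz px′ _ zx _ → cut (~-sym zx) px′ ¬pz)
    (λ e ¬px ¬py → pr (¬_ ∘ P) (~⇒≢ e) ¬px ¬py (λ k → k pa)
      λ ¬¬pz ¬px′ _ zx _ → ¬¬pz λ pz → cut zx pz ¬px′)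

  prime⇒coconnected : Prime → NonBipartite → Coconnected
  prime⇒coconnected pr nb P cut pa ¬pc = nb P
    (λ e px py → pr P (~⇒≢ e) px py ¬pc λ ¬pz _ py′ _ ¬zy → cut (≁-sym ¬zy) py′ ¬pz)
    (λ e ¬px ¬py → pr (¬_ ∘ P) (~⇒≢ e) ¬px ¬py (λ k → k pa)
      λ ¬¬pz _ ¬py′ _ ¬zy → ¬¬pz λ pz → cut ¬zy pz ¬py′)

  triangle⇒nonBipartite : ∀ {a b c} → a ~ b → a ~ c → b ~ c → NonBipartite
  triangle⇒nonBipartite {a} {b} {c} ab ac bc P in-P out-P =
    ¬¬-excluded-middle λ where
      (yes pa) → out-P bc (in-P ab pa) (in-P ac pa)
      (no ¬pa) → out-P ab ¬pa λ pb → out-P ac ¬pa λ pc → in-P bc pb pc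

-- The relation is adjacency for components and non-adjacency for anticomponents.
data Path {V : Set} (_R_ : V → V → Set) (P : V → Set) (a : V) : V → Set where
  here : P a → Path _R_ P a a
  step : ∀ {x y} → Path _R_ P a x → x R y → P y → Path _R_ P a y

module _ {V : Set} {_R_ : V → V → Set} {P : V → Set} where

  end : ∀ {a x} → Path _R_ P a x → P x
  end (here pa)     = pa
  end (step _ _ py) = py

  crossing : ∀ {Q : V → Set} (Q? : ∀ x → Dec (Q x)) {a y} → Path _R_ P a y → Q a → ¬ Q y →
             ∃₂ λ d d′ → Path _R_ P a d × Path _R_ P a d′ × d R d′ × Q d × ¬ Q d′
  crossing Q? (here _) qa ¬qy = contradiction qa ¬qy
  crossing Q? (step {x} {y} p r py) qa ¬qy with Q? x
  ... | yes qx = x , y , p , step p r py , r , qx , ¬qy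
  ... | no ¬qx = crossing Q? p qa ¬qx

  mixedStep : (∀ {x y} → x R y → y R x) → ∀ {Q : V → Set} (Q? : ∀ x → Dec (Q x)) {a x y} →
              Path _R_ P a x → Path _R_ P a y → Q x → ¬ Q y →
              ∃₂ λ d d′ → Path _R_ P a d × Path _R_ P a d′ × d R d′ × Q d × ¬ Q d′
  mixedStep R-sym Q? {a} p q qx ¬qy with Q? a
  ... | yes qa = crossing Q? q qa ¬qy
  mixedStep R-sym Q? {a} p q qx ¬qy | no ¬qa with crossing (¬? ∘ Q?) p ¬qa (λ k → k qx)
  ...   | d , d′ , pd , pd′ , r , ¬qd , ¬¬qd′ =
          d′ , d , pd′ , pd , R-sym r , decidable-stable (Q? d′) ¬¬qd′ , ¬qd

module _ (H : Gr) where
  open Gr H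

  -- A vertex mixed on the component of `a` in `P` splits one of its edges, and it lies outside `P`,
  -- since otherwise it would join the component. So excluding split edges makes the component a
  -- module.
  componentModule : Prime → (P : V → Set) → ∀ {a b c} → P a → P b → a ~ b → ¬ P c →
                    (∀ {t d d′} → ¬ P t → P d → P d′ → d ~ d′ → t ~ d → ¬ t ~ d′ → ⊥) → ⊥
  componentModule pr P {a} pa pb ab ¬pc sep =
    pr D (~⇒≢ ab) (here pa) (step (here pa) ab pb) (¬pc ∘ end) unmixed
    where
    D : V → Set
    D = Path _~_ P a
    unmixed : Unmixed D
    unmixed {z} ¬Dz dx dy zx ¬zy with mixedStep ~-sym (z ~?_) dx dy zx ¬zy
    ... | d , d′ , Dd , Dd′ , dd′ , zd , ¬zd′ =
      sep (λ pz → ¬Dz (step Dd (~-sym zd) pz)) (end Dd) (end Dd′) dd′ zd ¬zd′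

-- Preserving and reflecting adjacency allows only vertices with equal neighbourhoods to be
-- identified; injectivity is asked for separately where it matters.
record _↪_ (I G : Gr) : Set where
  private
    module I = Gr I
    module G = Gr G
  field
    to  : I.V → G.V
    ~⁺  : ∀ {i j} → i I.~ j → to i G.~ to j
    ~⁻  : ∀ {i j} → to i G.~ to j → i I.~ j

  ≁⁺ : ∀ {i j} → ¬ i I.~ j → ¬ to i G.~ to j
  ≁⁺ n e = n (~⁻ e)

id↪ : ∀ {G} → G ↪ G
id↪ = record { to = id ; ~⁺ = id ; ~⁻ = id }

-- Traces on a prime induced subgraph; centres and anticentres

module _ {I G : Gr} (φ : I ↪ G) where
  private module I = Gr I
  open Gr G
  open _↪_ φ

  -- The component of the trace of `w` that contains `ab` would be a module of `I`: if `t` outside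
  -- the trace splits its edge `d d′`, then `w d d′` is the triangle of a bull with pendants `v` and
  -- `t`.
  stableTrace : I.Prime → BullFree → ∀ {v w} → w ~ v → (∀ i → ¬ to i ~ v) →
                ∀ {a b c} → a I.~ b → w ~ to a → w ~ to b → ¬ w ~ to c → ⊥
  stableTrace prI bull {v} {w} wv anti ab wa wb ¬wc =
    componentModule I prI (λ i → w ~ to i) wa wb ab ¬wc
      λ {t} {d} {d′} ¬wt wd wd′ dd′ td ¬td′ →
        bull wd wd′ (~⁺ dd′) wv (~⁺ (I.~-sym td)) (anti d′) (≁⁺ (I.≁-sym ¬td′)) ¬wt (anti d)
             (≁-sym (anti t))

  -- X grows from I by the non-neighbours of v that are mixed on it, so whatever is mixed on X from
  -- outside is a neighbour of v; Y is the component of X after the deletion of Q.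
  noAdjacentCentreAnticentre : Prime → BullFree → HouseFree ⊎ (HammerFree × I.Prime × I.NonBipartite) →
    I.Connected → I.Coconnected → ∀ {i₀ j₀} → i₀ I.~ j₀ →
    ∀ {u v} → u ~ v → (∀ i → u ~ to i) → (∀ i → ¬ to i ~ v) → ⊥
  noAdjacentCentreAnticentre prG bull house⊎hammer connI coconnI {i₀} {j₀} i₀j₀ {u} {v} uv centre anti =
    prG Y (~⇒≢ (~⁺ i₀j₀)) (y-in (base i₀)) (y-in (base j₀)) ¬Yu unmixed
    where
    data X : V → Set where
      base : ∀ i → X (to i)
      grow : ∀ {w x y} → X x → X y → w ~ x → ¬ w ~ y → ¬ w ~ v → X w

    X-anti : ∀ {x} → X x → ¬ x ~ v
    X-anti (base i)          = anti i
    X-anti (grow _ _ _ _ ¬v) = ¬v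

    X∩N : V → V → Set
    X∩N w x = X x × w ~ x

    -- Growing never leaves the neighbourhood of `w`: a new `z` missed by `w` splits an edge `d d′`
    -- of the walks, and `w d d′` carries a bull with pendants `v` and `z`.
    pathInN : ∀ {w x} → w ~ v → (∀ i → w ~ to i) → X x → ¬ ¬ Path _~_ (X∩N w) (to i₀) x
    pathInN {w} wv c (base i) k =
      connI (λ j → Path _~_ (X∩N w) (to i₀) (to j))
            (λ {_} {y} xy p ¬p → ¬p (step p (~⁺ xy) (base y , c y))) (here (base i₀ , c i₀)) k
    pathInN {w} wv c (grow {z} x y zx ¬zy ¬zv) k =
      pathInN wv c x λ p → pathInN wv c y λ q → k (step p (~-sym zx) (grow x y zx ¬zy ¬zv , ~-stable λ ¬wz → hit p q ¬wz))
      where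
      hit : Path _~_ (X∩N w) (to i₀) _ → Path _~_ (X∩N w) (to i₀) _ → ¬ w ~ z → ⊥
      hit p q ¬wz with mixedStep ~-sym (z ~?_) p q zx ¬zy
      ... | d , d′ , pd , pd′ , dd′ , zd , ¬zd′ with end pd | end pd′
      ...   | Xd , wd | Xd′ , wd′ =
        bull wd wd′ dd′ wv (~-sym zd) (X-anti Xd′) (≁-sym ¬zd′) ¬wz (X-anti Xd) (¬zv ∘ ~-sym)

    complete : ∀ {w} → w ~ v → (∀ i → w ~ to i) → ∀ {x} → X x → w ~ x
    complete wv c x = ~-stable λ ¬wx → pathInN wv c x λ p → ¬wx (proj₂ (end p))

    copath : ∀ {x} → X x → ¬ ¬ Path (λ x y → ¬ x ~ y) X (to i₀) x
    copath (base i) k = coconnI (λ j → Path _ X (to i₀) (to j))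
      (λ {_} {y} ¬xy p ¬p → ¬p (step p (≁⁺ ¬xy) (base y))) (here (base i₀)) k
    copath (grow x y zx ¬zy ¬zv) k = copath y λ p → k (step p (≁-sym ¬zy) (grow x y zx ¬zy ¬zv))

    mixedEdge : ∀ {w x y} → X x → X y → w ~ x → ¬ w ~ y →
                (∀ {d d′} → X d → X d′ → d ~ d′ → w ~ d → ¬ w ~ d′ → ⊥) → ⊥
    mixedEdge {w} x y wx ¬wy k = pathInN uv centre x λ p → pathInN uv centre y λ q → go p q
      where
      go : Path _~_ (X∩N u) (to i₀) _ → Path _~_ (X∩N u) (to i₀) _ → ⊥
      go p q with mixedStep ~-sym (w ~?_) p q wx ¬wy
      ... | _ , _ , pd , pd′ , dd′ , wd , ¬wd′ = k (proj₁ (end pd)) (proj₁ (end pd′)) dd′ wd ¬wd′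

    mixedNonedge : ∀ {w x y} → X x → X y → w ~ x → ¬ w ~ y →
                   (∀ {d d′} → X d → X d′ → ¬ d ~ d′ → w ~ d → ¬ w ~ d′ → ⊥) → ⊥
    mixedNonedge {w} x y wx ¬wy k = copath x λ p → copath y λ q → go p q
      where
      go : Path _ X (to i₀) _ → Path _ X (to i₀) _ → ⊥
      go p q with mixedStep ≁-sym (w ~?_) p q wx ¬wy
      ... | _ , _ , pd , pd′ , dd′ , wd , ¬wd′ = k (end pd) (end pd′) dd′ wd ¬wd′

    Complete Anticomplete : V → Set
    Complete q     = ∀ {x} → X x → q ~ x
    Anticomplete p = ∀ {x} → X x → ¬ p ~ x

    -- Among the vertices complete to `X`, the union of those anticomponents that contain a vertex
    -- with a neighbour anticomplete to `X`. The pair `u`, `v` makes it nonempty.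
    data Q : V → Set where
      q-in  : ∀ {q p} → Complete q → Anticomplete p → q ~ p → Q q
      q-add : ∀ {t q} → Complete t → Q q → ¬ t ~ q → Q t

    Q-complete : ∀ {q} → Q q → Complete q
    Q-complete (q-in c _ _)  = c
    Q-complete (q-add c _ _) = c

    -- If `w` saw an edge of `I`, it would be complete to `X`. So it misses one, as its trace is no
    -- bipartition class; that edge and `q` form the triangle of a hammer with tail `q p w`.
    hammerAt : HammerFree → I.Prime → I.NonBipartite → ∀ {w q p y} → X y → ¬ w ~ y → w ~ v →
               Complete q → Anticomplete p → q ~ p → w ~ p → ¬ w ~ q → ⊥
    hammerAt hammer prI nbI {w} y ¬wy wv cq ap qp wp ¬wq = nbI (λ i → w ~ to i)
      (λ ij wi wj → ¬wy (complete wv (λ c → ~-stable (stableTrace prI bull wv anti ij wi wj)) y))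
      (λ {i} {j} ij ¬wi ¬wj → hammer (~⁺ ij) (~-sym (cq (base i))) (~-sym (cq (base j))) qp (~-sym wp)
        (ap (base i) ∘ ~-sym) (ap (base j) ∘ ~-sym) (≁-sym ¬wi) (≁-sym ¬wj) (≁-sym ¬wq))

    -- Induction along `Q`. For a starting vertex `q`, an edge of `X` split by `w` gives a bull with
    -- pendants `p` and `w`, or, if `w` sees `p`, the square `d q p w` with roof `d′`. For an added
    -- `t`, a split nonedge gives the square `d q d′ t` with roof `w`. Hammers use in addition that
    -- `w` sees `v`, by the maximality of `X`.
    mixed~Q : ∀ {w x y q} → ¬ X w → X x → X y → w ~ x → ¬ w ~ y → Q q → w ~ q
    mixed~Q {w} {x} {y} ¬Xw Xx Xy wx ¬wy = go
      where
      wv : w ~ v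
      wv = ~-stable λ ¬wv → ¬Xw (grow Xx Xy wx ¬wy ¬wv)

      go : ∀ {q} → Q q → w ~ q
      go {q} (q-in {p = p} cq ap qp) = ~-stable λ ¬wq → mixedEdge Xx Xy wx ¬wy λ {d} {d′} Xd Xd′ dd′ wd ¬wd′ →
        clash ¬wq Xd Xd′ dd′ wd ¬wd′ (w ~? p) house⊎hammer
        where
        clash : ¬ w ~ q → ∀ {d d′} → X d → X d′ → d ~ d′ → w ~ d → ¬ w ~ d′ → Dec (w ~ p) →
                HouseFree ⊎ (HammerFree × I.Prime × I.NonBipartite) → ⊥
        clash ¬wq Xd Xd′ dd′ wd ¬wd′ (no ¬wp) _ =
          bull (cq Xd) (cq Xd′) dd′ qp (~-sym wd) (≁-sym (ap Xd′)) (≁-sym ¬wd′) (≁-sym ¬wq) (≁-sym (ap Xd)) (≁-sym ¬wp)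
        clash ¬wq Xd Xd′ dd′ wd ¬wd′ (yes wp) (inj₁ house) =
          house (~-sym (cq Xd)) qp (~-sym wp) wd (~-sym dd′) (~-sym (cq Xd′))
                (≁-sym (ap Xd)) (≁-sym ¬wq) (≁-sym (ap Xd′)) (≁-sym ¬wd′)
        clash ¬wq Xd Xd′ dd′ wd ¬wd′ (yes wp) (inj₂ (hammer , prI , nbI)) =
          hammerAt hammer prI nbI Xy ¬wy wv cq ap qp wp ¬wq
      go {t} (q-add {q = q} ct Qq ¬tq) = ~-stable (clash house⊎hammer)
        where
        clash : HouseFree ⊎ (HammerFree × I.Prime × I.NonBipartite) → ¬ w ~ t → ⊥
        clash (inj₁ house) ¬wt = mixedNonedge Xx Xy wx ¬wy λ Xd Xd′ ¬dd′ wd ¬wd′ →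
          house (~-sym (Q-complete Qq Xd)) (Q-complete Qq Xd′) (~-sym (ct Xd′)) (ct Xd) wd (go Qq)
                ¬dd′ (≁-sym ¬tq) ¬wd′ ¬wt
        clash (inj₂ (hammer , prI , nbI)) ¬wt with t ~? v
        ... | yes tv = hammerAt hammer prI nbI Xy ¬wy wv ct (λ Xx′ → X-anti Xx′ ∘ ~-sym) tv wv ¬wt
        ... | no ¬tv = mixedEdge Xx Xy wx ¬wy λ Xd Xd′ dd′ wd ¬wd′ →
          hammer (ct Xd′) (ct Xd) (~-sym dd′) (~-sym wd) wv (≁-sym ¬wt) (≁-sym ¬wd′) ¬tv (X-anti Xd′) (X-anti Xd)

    data Y : V → Set where
      y-in  : ∀ {x} → X x → Y x
      y-add : ∀ {r y} → Y r → ¬ Q y → r ~ y → Y y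

    Y⇒¬Q : ∀ {y} → Y y → ¬ Q y
    Y⇒¬Q (y-in x)      Qx = ~-irr (Q-complete Qx x)
    Y⇒¬Q (y-add _ ¬Qy _) = ¬Qy

    -- Outside `X`, such a `y` is mixed on `X`, hence complete to `Q`, or complete to `X`, and then
    -- a missed `q` would pull it into `Q`.
    touching~Q : ∀ {y x q} → ¬ Q y → X x → y ~ x → Q q → y ~ q
    touching~Q {y} {x} {q} ¬Qy Xx yx Qq = ~-stable λ ¬yq → ¬¬-excluded-middle λ where
      (yes Xy) → ¬yq (~-sym (Q-complete Qq Xy))
      (no ¬Xy) → ¬Qy (q-add (λ Xx′ → ~-stable λ ¬yx′ → ¬yq (mixed~Q ¬Xy Xx Xx′ yx ¬yx′ Qq)) Qq ¬yq)

    Y~Q     : ∀ {r q} → Y r → Q q → r ~ q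
    -- The hard case is an induced path `t r y` with `y` missing `q`. Then `y` is anticomplete to
    -- `X`, and bulls leave two options: `r` is complete to `X` and has the neighbour `y`, or `r` is
    -- anticomplete to `X` and `t` is complete to it. So `r` or `t` would be in `Q`.
    beyondY : ∀ {r y q} → Y r → r ~ y → ¬ Q y → Q q → y ~ q
    Y~Q (y-in Xr) Qq           = ~-sym (Q-complete Qq Xr)
    Y~Q (y-add Yt ¬Qr tr) Qq = beyondY Yt tr ¬Qr Qq
    beyondY (y-in Xr) ry ¬Qy Qq = touching~Q ¬Qy Xr (~-sym ry) Qq
    beyondY {r} {y} {q} (y-add {t} Yt ¬Qr tr) ry ¬Qy Qq = ~-stable λ ¬yq →
      clash ¬yq (λ Xx yx → ¬yq (touching~Q ¬Qy Xx yx Qq)) (y ~? t)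
      where
      rq : r ~ q
      rq = beyondY Yt tr ¬Qr Qq
      clash : ¬ y ~ q → Anticomplete y → Dec (y ~ t) → ⊥
      clash ¬yq ay (yes yt) = ¬yq (beyondY Yt (~-sym yt) ¬Qy Qq)
      clash ¬yq ay (no ¬yt) = r-anti λ {x} Xx rx → ¬Qr (q-in (λ Xx′ → ~-stable λ ¬rx′ → r-mixed Xx Xx′ rx ¬rx′) ay ry)
        where
        r-mixed : ∀ {x x′} → X x → X x′ → r ~ x → ¬ r ~ x′ → ⊥
        r-mixed Xx Xx′ rx ¬rx′ = mixedNonedge Xx Xx′ rx ¬rx′ λ Xd Xd′ ¬dd′ rd ¬rd′ →
          bull rq rd (Q-complete Qq Xd) ry (Q-complete Qq Xd′) (≁-sym (ay Xd)) ¬dd′ ¬rd′ (≁-sym ¬yq) (ay Xd′)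
        r-anti : ¬ Anticomplete r
        r-anti ar = Y⇒¬Q Yt (q-in (λ Xx → ~-stable λ ¬tx →
          bull rq (~-sym tr) (~-sym (Y~Q Yt Qq)) ry (Q-complete Qq Xx) (≁-sym ¬yt) ¬tx (ar Xx) (≁-sym ¬yq) (ay Xx))
          ar tr)

    Qu : Q u
    Qu = q-in (complete uv centre) (λ Xx → X-anti Xx ∘ ~-sym) uv

    ¬Yu : ¬ Y u
    ¬Yu Yu = Y⇒¬Q Yu Qu

    unmixed : Unmixed Y
    unmixed ¬Yz Yx Yy zx ¬zy = ¬Yz (y-add Yx (λ Qz → ¬zy (~-sym (Y~Q Yy Qz))) (~-sym zx))

  -- An edge in the trace would make `w` a centre adjacent to the anticentre `v`.
  adjacentTrace : Prime → BullFree → HouseFree ⊎ HammerFree → I.Prime → I.NonBipartite →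
    ∀ {v w} → w ~ v → (∀ i → ¬ to i ~ v) → ∀ {a b} → a I.~ b → w ~ to a → w ~ to b → ⊥
  adjacentTrace prG bull house⊎hammer prI nbI wv anti ab wa wb =
    noAdjacentCentreAnticentre prG bull (alternatives house⊎hammer)
      (I.prime⇒connected prI nbI) (I.prime⇒coconnected prI nbI) ab
      wv (λ c → ~-stable (stableTrace prI bull wv anti ab wa wb)) anti
    where
    alternatives : HouseFree ⊎ HammerFree → HouseFree ⊎ (HammerFree × I.Prime × I.NonBipartite)
    alternatives (inj₁ house)  = inj₁ house
    alternatives (inj₂ hammer) = inj₂ (hammer , prI , nbI)

  -- Without hammers: triangles carry anticompleteness along

  module _ (prG : Prime) (bull : BullFree) (hammer : HammerFree) (prI : I.Prime) (nbI : I.NonBipartite) where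

    private
      connI : I.Connected
      connI = I.prime⇒connected prI nbI

      hammerTrace : ∀ {v w} → w ~ v → (∀ i → ¬ to i ~ v) → ∀ {a b} → a I.~ b → w ~ to a → w ~ to b → ⊥
      hammerTrace = adjacentTrace prG bull (inj₂ hammer) prI nbI

    -- If `x` sees `I`, its trace is stable, so it misses an edge, and one end of that edge is
    -- missed by `y` too. Around such a far vertex, hammers force every vertex of `I` to be seen by
    -- both `x` and `y` or by neither, and both classes are stable.
    trianglesSpreadAnti : ∀ {v x y} → v ~ x → v ~ y → x ~ y → (∀ i → ¬ to i ~ v) → ∀ i → ¬ x ~ to i
    trianglesSpreadAnti {v} {x} {y} vx vy xy anti a₀ xa₀ = nbI (λ i → x ~ to i) x-stable
      λ {i} ij ¬xi ¬xj → unseenEdge ij ¬xi ¬xj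
      where
      x-stable : ∀ {a b} → a I.~ b → x ~ to a → x ~ to b → ⊥
      x-stable = hammerTrace (~-sym vx) anti
      y-stable : ∀ {a b} → a I.~ b → y ~ to a → y ~ to b → ⊥
      y-stable = hammerTrace (~-sym vy) anti

      Far Both : I.V → Set
      Far i  = ¬ x ~ to i × ¬ y ~ to i
      Both i = x ~ to i × y ~ to i

      far-near : ∀ {z a} → Far z → ¬ Far a → z I.~ a → Both a
      far-near {z} {a} (¬xz , ¬yz) near za with x ~? to a | y ~? to a
      ... | yes xa | yes ya = xa , ya
      ... | no ¬xa | no ¬ya = contradiction (¬xa , ¬ya) near
      ... | yes xa | no ¬ya = ⊥-elim (hammer vy vx (~-sym xy) xa (~⁺ (I.~-sym za)) (≁-sym (anti a)) ¬ya
                                            (≁-sym (anti z)) ¬yz ¬xz)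
      ... | no ¬xa | yes ya = ⊥-elim (hammer vx vy xy ya (~⁺ (I.~-sym za)) (≁-sym (anti a)) ¬xa
                                            (≁-sym (anti z)) ¬xz ¬yz)

      far-far : ∀ {z a c} → Far z → Both a → Far c → z I.~ a → z I.~ c → ⊥
      far-far {z} {a} {c} (¬xz , ¬yz) (xa , ya) (¬xc , ¬yc) za zc with c I.~? a
      ... | yes ca = hammer (~⁺ zc) (~⁺ za) (~⁺ ca) (~-sym xa) (~-sym vx) (≁-sym ¬xz) (≁-sym ¬xc) (anti z) (anti c) (anti a)
      ... | no ¬ca = hammer xy xa ya (~⁺ (I.~-sym za)) (~⁺ zc) ¬xz ¬yz ¬xc ¬yc (≁⁺ (I.≁-sym ¬ca))

      data S : I.V → Set where
        both : ∀ {a} → Both a → S a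
        far  : ∀ {a z} → Both a → Far z → z I.~ a → S z

      S-closed : ∀ {i j} → i I.~ j → S i → ¬ S j → ⊥
      S-closed {i} {j} ij (both (xi , yi)) ¬Sj =
        ¬Sj (far (xi , yi) (x-stable ij xi , y-stable ij yi) (I.~-sym ij))
      S-closed {i} {j} ij (far Ba Fi ia) ¬Sj = ¬Sj (both (far-near Fi (λ Fj → far-far Fi Ba Fj ia ij) ij))

      ¬¬S : ∀ {a z} → Both a → Far z → z I.~ a → ∀ i → ¬ ¬ S i
      ¬¬S Ba Fz za i ¬Si = connI S S-closed (far Ba Fz za) ¬Si

      unseenEdge : ∀ {i j} → i I.~ j → ¬ x ~ to i → ¬ x ~ to j → ⊥
      unseenEdge {i} {j} ij ¬xi ¬xj = connI Far leave (proj₂ (farEnd i j ij ¬xi ¬xj)) (λ F → proj₁ F xa₀)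
        where
        farEnd : ∀ i j → i I.~ j → ¬ x ~ to i → ¬ x ~ to j → ∃ Far
        farEnd i j ij ¬xi ¬xj with y ~? to i
        ... | no ¬yi = i , ¬xi , ¬yi
        ... | yes yi = j , ¬xj , λ yj → y-stable ij yi yj
        leave : ∀ {z a} → z I.~ a → Far z → ¬ Far a → ⊥
        leave za Fz near = nbI Both (λ pq p q → x-stable pq (proj₁ p) (proj₁ q)) λ {p} {q} pq ¬Bp ¬Bq →
          ¬¬S Ba Fz za p λ Sp → ¬¬S Ba Fz za q λ Sq → apart pq ¬Bp ¬Bq Sp Sq
          where
          Ba = far-near Fz near za
          apart : ∀ {p q} → p I.~ q → ¬ Both p → ¬ Both q → S p → S q → ⊥
          apart pq ¬Bp ¬Bq (both Bp) _          = ¬Bp Bp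
          apart pq ¬Bp ¬Bq _         (both Bq)  = ¬Bq Bq
          apart pq ¬Bp ¬Bq (far Ba Fp pa) (far _ Fq _) = far-far Fp Ba Fq pa pq

    -- Let `D` be the neighbours of those triangle vertices that are anticomplete to `I`. Avoiding
    -- hammers makes `D` anticomplete to `I` and closed under adjacency, so it is all of `G`,
    -- including `I`.
    hammerAnti : Connected → ∀ {v x y} → v ~ x → v ~ y → x ~ y → (∀ i → ¬ to i ~ v) → ⊥
    hammerAnti connG {v} {x} {y} vx vy xy anti =
      nbI (λ _ → ⊤) (λ {i} ij _ _ → all-anti (to i) λ Di → D-anti Di _ (~⁺ ij)) λ _ ¬⊤ _ → ¬⊤ tt
      where
      Anti : V → Set
      Anti p = ∀ i → ¬ p ~ to i

      data D (p : V) : Set where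
        near : ∀ {a b c} → a ~ b → a ~ c → b ~ c → Anti a → p ~ a → D p

      spread : ∀ {a b c} → a ~ b → a ~ c → b ~ c → Anti a → Anti b
      spread ab ac bc aa = trianglesSpreadAnti ab ac bc (λ i → aa i ∘ ~-sym)

      D-anti : ∀ {p} → D p → Anti p
      D-anti {p} (near {a} {b} {c} ab ac bc aa pa) f pf with p ~? b | p ~? c
      ... | yes pb | _      = spread (~-sym pa) ab pb aa f pf
      ... | no _   | yes pc = spread (~-sym pa) ac pc aa f pf
      ... | no ¬pb | no ¬pc = hammer bc (~-sym ab) (~-sym ac) (~-sym pa) pf (≁-sym ¬pb) (≁-sym ¬pc)
                                (spread ab ac bc aa f) (spread ac ab (~-sym bc) aa f) (aa f)

      D-closed : ∀ {p q} → p ~ q → D p → ¬ D q → ⊥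
      D-closed {p} {q} pq Dp@(near {a} {b} {c} ab ac bc aa pa) ¬Dq with p ~? b | p ~? c | q ~? a | q ~? b | q ~? c
      ... | yes pb | _ | _ | _ | _ = ¬Dq (near pa pb ab (D-anti Dp) (~-sym pq))
      ... | _ | yes pc | _ | _ | _ = ¬Dq (near pa pc ac (D-anti Dp) (~-sym pq))
      ... | _ | _ | yes qa | _ | _ = ¬Dq (near ab ac bc aa qa)
      ... | _ | _ | _ | yes qb | _ = ¬Dq (near (~-sym ab) bc ac (spread ab ac bc aa) qb)
      ... | _ | _ | _ | _ | yes qc = ¬Dq (near (~-sym ac) (~-sym bc) ab (spread ac ab (~-sym bc) aa) qc)
      ... | no ¬pb | no ¬pc | no ¬qa | no ¬qb | no ¬qc =
        hammer bc (~-sym ab) (~-sym ac) (~-sym pa) pq (≁-sym ¬pb) (≁-sym ¬pc) (≁-sym ¬qb) (≁-sym ¬qc) (≁-sym ¬qa)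

      all-anti : ∀ p → ¬ ¬ D p
      all-anti p ¬Dp = connG D D-closed {x} (near vx vy xy (λ i → anti i ∘ ~-sym) (~-sym vx)) ¬Dp

  -- Without houses: neighbourhoods, twins and equal traces

  -- Within the neighbourhood of `x`, `P` is a union of components missed by `l`. The component of
  -- `gh` is a module of `I`: a `t` splitting its edge `d d′` misses `x`, which gives a bull with
  -- pendants `l` and `t`, or, when `l` sees `t`, the square `d x l t` with roof `d′`.
  hoodConnected : I.Prime → BullFree → HouseFree → ∀ {x l} → l ~ to x → (P : I.V → Set) →
    (∀ {y z} → P y → y I.~ z → z I.~ x → ¬ P z → ⊥) → (∀ {y} → P y → ¬ l ~ to y) →
    ∀ {g h} → P g → g I.~ x → h I.~ x → g I.~ h → ⊥
  hoodConnected prI bull house {x} {l} lx P closed avoid Pg gx hx gh = closed Pg gh hx λ Ph →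
    componentModule I prI (λ y → P y × y I.~ x) (Pg , gx) (Ph , hx) gh (λ k → I.~-irr (proj₂ k))
      λ {t} ¬t (Pd , dx) (Pd′ , d′x) dd′ td ¬td′ →
        let ¬tx = λ tx → closed Pd (I.~-sym td) tx λ Pt → ¬t (Pt , tx)
        in clash Pd Pd′ dx d′x dd′ td ¬td′ ¬tx (l ~? to t)
    where
    clash : ∀ {t d d′} → P d → P d′ → d I.~ x → d′ I.~ x → d I.~ d′ → t I.~ d → ¬ t I.~ d′ →
            ¬ t I.~ x → Dec (l ~ to t) → ⊥
    clash Pd Pd′ dx d′x dd′ td ¬td′ ¬tx (no ¬lt) =
      bull (~⁺ (I.~-sym dx)) (~⁺ (I.~-sym d′x)) (~⁺ dd′) (~-sym lx) (~⁺ (I.~-sym td))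
           (≁-sym (avoid Pd′)) (≁⁺ (I.≁-sym ¬td′)) (≁⁺ (I.≁-sym ¬tx)) (≁-sym (avoid Pd)) ¬lt
    clash Pd Pd′ dx d′x dd′ td ¬td′ ¬tx (yes lt) =
      house (~⁺ dx) (~-sym lx) lt (~⁺ td) (~⁺ (I.~-sym dd′)) (~⁺ d′x)
            (≁-sym (avoid Pd)) (≁⁺ (I.≁-sym ¬tx)) (≁-sym (avoid Pd′)) (≁⁺ (I.≁-sym ¬td′))

  hoodNotIsolated : I.Prime → BullFree → HouseFree → ∀ {x l} → l ~ to x →
    (∀ {y} → y I.~ x → ¬ l ~ to y) → I.NoTriangleAt x
  hoodNotIsolated prI bull house {x} lx isolated xb xc bc =
    hoodConnected prI bull house lx (I._~ x) (λ _ _ zx ¬zx → ¬zx zx) isolated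
      (I.~-sym xb) (I.~-sym xb) (I.~-sym xc) bc

  -- `i` is isolated in the neighbourhood of `j`, so this neighbourhood has no edge.
  noTriangleSpreads : I.Prime → BullFree → HouseFree → ∀ {i j} → i I.~ j → I.NoTriangleAt i → I.NoTriangleAt j
  noTriangleSpreads prI bull house ij ¬Δ =
    hoodNotIsolated prI bull house (~⁺ ij) λ yj iy → ¬Δ ij (~⁻ iy) (I.~-sym yj)

  module _ (bull : BullFree) (house : HouseFree) (Δ-free : ∀ {i} → I.NoTriangleAt i)
           {p : V} {e b : I.V} (be : b I.~ e) (pe : p ~ to e) (¬pb : ¬ p ~ to b) where

    -- If `p` missed `f`, there would be a bull on `p e e′` with pendants `b` and `f`, or a house
    -- with roof `p` on the square `e′ e b f`.
    edgeTrace⊇ : ∀ {e′ f} → e I.~ e′ → p ~ to e′ → f I.~ e′ → p ~ to f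
    edgeTrace⊇ {e′} {f} ee′ pe′ fe′ = ~-stable λ ¬pf → clash ¬pf (b I.~? f)
      where
      ¬fe : ¬ f I.~ e
      ¬fe fe = Δ-free fe fe′ ee′
      ¬be′ : ¬ b I.~ e′
      ¬be′ be′ = Δ-free be be′ ee′
      clash : ¬ p ~ to f → Dec (b I.~ f) → ⊥
      clash ¬pf (no ¬bf) = bull (~⁺ ee′) (~-sym pe) (~-sym pe′) (~⁺ (I.~-sym be)) (~⁺ (I.~-sym fe′)) ¬pb ¬pf
                             (≁⁺ (I.≁-sym ¬fe)) (≁⁺ (I.≁-sym ¬be′)) (≁⁺ ¬bf)
      clash ¬pf (yes bf) = house (~⁺ (I.~-sym ee′)) (~⁺ (I.~-sym be)) (~⁺ bf) (~⁺ fe′) pe′ pe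
                             (≁⁺ (I.≁-sym ¬be′)) (≁⁺ (I.≁-sym ¬fe)) ¬pb ¬pf

    edgeTrace⊆ : ∀ {e′ f} → e I.~ e′ → p ~ to e′ → p ~ to f → ¬ f I.~ e → ¬ f I.~ e′ → ⊥
    edgeTrace⊆ {e′} {f} ee′ pe′ pf ¬fe ¬fe′ = clash (f I.~? b)
      where
      ¬be′ : ¬ b I.~ e′
      ¬be′ be′ = Δ-free be be′ ee′
      clash : Dec (f I.~ b) → ⊥
      clash (no ¬fb) = bull (~-sym pe) (~⁺ ee′) pe′ (~⁺ (I.~-sym be)) pf (≁⁺ (I.≁-sym ¬be′)) (≁⁺ (I.≁-sym ¬fe′))
                         (≁⁺ (I.≁-sym ¬fe)) ¬pb (≁⁺ (I.≁-sym ¬fb))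
      clash (yes fb) = house pe (~⁺ (I.~-sym be)) (~⁺ (I.~-sym fb)) (~-sym pf) (~-sym pe′) (~⁺ (I.~-sym ee′))
                         ¬pb (≁⁺ (I.≁-sym ¬fe)) (≁⁺ (I.≁-sym ¬be′)) (≁⁺ (I.≁-sym ¬fe′))

    -- With `edgeTrace⊇`, the trace of `p` is exactly `e′` and its neighbours, so `p` is an adjacent
    -- twin of `e′`. A further `f` adjacent to `e` is excluded because `e′` and `f` would form a
    -- module.
    edgeTraceStar : I.Prime → ∀ {e′ f} → e I.~ e′ → p ~ to e′ → p ~ to f → f ≢ e′ → ¬ ¬ f I.~ e′
    edgeTraceStar prI {e′} {f} ee′ pe′ pf f≢e′ ¬fe′ = edgeTrace⊆ ee′ pe′ pf
      (λ fe → prI (λ x → x ≡ e′ ⊎ x ≡ f) f≢e′ (inj₂ refl) (inj₁ refl) e-out (unmixed (I.~-sym fe))) ¬fe′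
      where
      e-out : ¬ (e ≡ e′ ⊎ e ≡ f)
      e-out (inj₁ refl) = I.~-irr ee′
      e-out (inj₂ refl) = ¬fe′ ee′
      separated : ∀ {z g h} → e I.~ g → p ~ to g → e I.~ h → p ~ to h → z I.~ g → ¬ z I.~ h → ⊥
      separated eg pg eh ph zg ¬zh =
        edgeTrace⊆ eh ph (edgeTrace⊇ eg pg zg) (λ ze → Δ-free ze zg eg) ¬zh
      unmixed : e I.~ f → I.Unmixed (λ x → x ≡ e′ ⊎ x ≡ f)
      unmixed ef _ (inj₁ refl) (inj₁ refl) zx ¬zy = ¬zy zx
      unmixed ef _ (inj₁ refl) (inj₂ refl) zx ¬zy = separated ee′ pe′ ef pf zx ¬zy
      unmixed ef _ (inj₂ refl) (inj₁ refl) zx ¬zy = separated ef pf ee′ pe′ zx ¬zy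
      unmixed ef _ (inj₂ refl) (inj₂ refl) zx ¬zy = ¬zy zx

module _ {I G : Gr} (φ : I ↪ G) where
  private module I = Gr I
  open Gr G
  open _↪_ φ

  -- What `d` needs in order to take the place of `i₀`. Adjacency of `d` and `to i₀` is left open,
  -- so `to i₀` itself qualifies.
  TwinOf : I.V → V → Set
  TwinOf i₀ d = ∀ {j} → j ≢ i₀ → (d ~ to j → i₀ I.~ j) × (i₀ I.~ j → d ~ to j)

  module _ (i₀ : I.V) {d : V} (twin : TwinOf i₀ d) where

    replaced : I.V → V
    replaced j with j I.≟ i₀
    ... | yes _ = d
    ... | no _  = to j

    replaced-at : replaced i₀ ≡ d
    replaced-at with i₀ I.≟ i₀
    ... | yes _ = refl
    ... | no i₀≢i₀ = contradiction refl i₀≢i₀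

    replaced-off : ∀ {j} → j ≢ i₀ → replaced j ≡ to j
    replaced-off {j} j≢i₀ with j I.≟ i₀
    ... | yes j≡i₀ = contradiction j≡i₀ j≢i₀
    ... | no _ = refl

    replace : I ↪ G
    replace = record { to = replaced ; ~⁺ = preserves ; ~⁻ = reflects }
      where
      preserves : ∀ {i j} → i I.~ j → replaced i ~ replaced j
      preserves {i} {j} ij with i I.≟ i₀ | j I.≟ i₀
      ... | yes refl | yes refl = contradiction ij I.~-irr
      ... | yes refl | no j≢    = proj₂ (twin j≢) ij
      ... | no i≢    | yes refl = ~-sym (proj₂ (twin i≢) (I.~-sym ij))
      ... | no _     | no _     = ~⁺ ij
      reflects : ∀ {i j} → replaced i ~ replaced j → i I.~ j
      reflects {i} {j} ij with i I.≟ i₀ | j I.≟ i₀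
      ... | yes refl | yes refl = contradiction ij ~-irr
      ... | yes refl | no j≢    = proj₁ (twin j≢) ij
      ... | no i≢    | yes refl = I.~-sym (proj₁ (twin i≢) (~-sym ij))
      ... | no _     | no _     = ~⁻ ij

  module _ (prG : Prime) (bull : BullFree) (house : HouseFree) (prI : I.Prime) (nbI : I.NonBipartite)
           (Δ-free : ∀ {i} → I.NoTriangleAt i) where

    private
      connI : I.Connected
      connI = I.prime⇒connected prI nbI

    -- Without a path of length two starting at `i`, the connected graph `I` would be a star centred
    -- at `i`, hence bipartite.
    pathFrom : ∀ i → (∀ {q b} → q I.~ i → q I.~ b → b ≢ i → ⊥) → ⊥
    pathFrom i k = nbI (_≡ i) (λ { ab refl refl → I.~-irr ab }) λ {a} {c} ac a≢i c≢i →
      connI (λ x → x ≡ i ⊎ x I.~ i) leave {i} {a} (inj₁ refl) λ where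
        (inj₁ a≡i) → a≢i a≡i
        (inj₂ ai)  → k ai ac c≢i
      where
      leave : ∀ {x y} → x I.~ y → x ≡ i ⊎ x I.~ i → ¬ (y ≡ i ⊎ y I.~ i) → ⊥
      leave xy (inj₁ refl) ¬y = ¬y (inj₂ (I.~-sym xy))
      leave xy (inj₂ xi)   ¬y = k xi xy (¬y ∘ inj₁)

    -- Either of `d`, `d′` can play `i₀`. Let `b` be at distance two from `i₀`. If `z` misses `b`,
    -- then with `d` in the role `z` is a twin of `i₀`. If `z` sees `b`, then with `d′` in the role
    -- `z` is a twin of `b`; comparing the two roles, `i₀` and `b` form one class of a bipartition
    -- of `I`.
    twinsUnmixed : ∀ {i₀ d d′ z} → TwinOf i₀ d → TwinOf i₀ d′ → d ~ d′ → z ~ d → ¬ z ~ d′ → ¬ ¬ TwinOf i₀ z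
    twinsUnmixed {i₀} {d} {d′} {z} td td′ dd′ zd ¬zd′ ¬tz =
      pathFrom i₀ λ {q} {b} qi₀ qb b≢i₀ → split qi₀ qb b≢i₀ (z ~? to b)
      where
      φd φd′ : I ↪ G
      φd  = replace i₀ td
      φd′ = replace i₀ td′

      at : ∀ {d} (t : TwinOf i₀ d) → z ~ d → z ~ replaced i₀ t i₀
      at t = subst (z ~_) (sym (replaced-at i₀ t))
      at⁻ : ∀ {d} (t : TwinOf i₀ d) → z ~ replaced i₀ t i₀ → z ~ d
      at⁻ t = subst (z ~_) (replaced-at i₀ t)
      off : ∀ {d} (t : TwinOf i₀ d) {j} → j ≢ i₀ → z ~ to j → z ~ replaced i₀ t j
      off t j≢ = subst (z ~_) (sym (replaced-off i₀ t j≢))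
      off⁻ : ∀ {d} (t : TwinOf i₀ d) {j} → j ≢ i₀ → z ~ replaced i₀ t j → z ~ to j
      off⁻ t j≢ = subst (z ~_) (replaced-off i₀ t j≢)

      z~nbr : ∀ {q k} → q I.~ i₀ → q I.~ k → k ≢ i₀ → z ~ to q
      z~nbr {q} {k} qi₀ qk k≢i₀ = ~-stable λ ¬zq → clash ¬zq (z ~? to k)
        where
        q≢i₀ : q ≢ i₀
        q≢i₀ = I.~⇒≢ qi₀
        dq : ∀ {d} → TwinOf i₀ d → d ~ to q
        dq t = proj₂ (t q≢i₀) (I.~-sym qi₀)
        ¬dk : ∀ {d} → TwinOf i₀ d → ¬ d ~ to k
        ¬dk t dk = Δ-free qi₀ qk (proj₁ (t k≢i₀) dk)
        clash : ¬ z ~ to q → Dec (z ~ to k) → ⊥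
        clash ¬zq (no ¬zk) = bull (dq td) dd′ (~-sym (dq td′)) (~-sym zd) (~⁺ qk)
          (≁-sym ¬zd′) (¬dk td′) (¬dk td) (≁-sym ¬zq) ¬zk
        clash ¬zq (yes zk) = house (~-sym (dq td)) (~-sym zd) zk (~⁺ (I.~-sym qk)) (dq td′) (~-sym dd′)
          (≁-sym ¬zq) (¬dk td) (≁-sym ¬zd′) (¬dk td′)

      split : ∀ {q b} → q I.~ i₀ → q I.~ b → b ≢ i₀ → Dec (z ~ to b) → ⊥
      split {q} {b} qi₀ qb b≢i₀ (no ¬zb) = ¬tz λ {j} j≢i₀ →
          (λ zj → I.~-stable λ ¬i₀j → star (off td j≢i₀ zj) j≢i₀ (I.≁-sym ¬i₀j))
        , (λ i₀j → off⁻ td j≢i₀ (edgeTrace⊇ φd bull house Δ-free bq zq ¬zb′ qi₀ (at td zd) (I.~-sym i₀j)))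
        where
        bq  = I.~-sym qb
        zq  = off td (I.~⇒≢ qi₀) (z~nbr qi₀ qb b≢i₀)
        ¬zb′ = λ zb → ¬zb (off⁻ td b≢i₀ zb)
        star : ∀ {f} → z ~ replaced i₀ td f → f ≢ i₀ → ¬ ¬ f I.~ i₀
        star = edgeTraceStar φd bull house Δ-free bq zq ¬zb′ prI qi₀ (at td zd)
      split {q} {b} qi₀ qb b≢i₀ (yes zb) = nbI (λ x → x ≡ i₀ ⊎ x ≡ b) inside outside
        where
        zq = z~nbr qi₀ qb b≢i₀
        ¬zi₀ = λ zi₀ → ¬zd′ (at⁻ td′ zi₀)
        i₀q = I.~-sym qi₀
        ¬bi₀ : ¬ b I.~ i₀
        ¬bi₀ bi₀ = Δ-free qb qi₀ bi₀

        star : ∀ {f} → f ≢ i₀ → z ~ to f → f ≢ b → ¬ ¬ f I.~ b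
        star f≢i₀ zf = edgeTraceStar φd′ bull house Δ-free i₀q (off td′ (I.~⇒≢ qi₀) zq) ¬zi₀ prI qb
                         (off td′ b≢i₀ zb) (off td′ f≢i₀ zf)
        star⁻ : ∀ {f} → f I.~ b → z ~ to f
        star⁻ {f} fb = off⁻ td′ (λ { refl → ¬bi₀ (I.~-sym fb) })
          (edgeTrace⊇ φd′ bull house Δ-free i₀q (off td′ (I.~⇒≢ qi₀) zq) ¬zi₀ qb (off td′ b≢i₀ zb) fb)

        beyondNbr : ∀ {e k} → e I.~ b → k I.~ e → k ≢ i₀ → k ≢ b → ⊥
        beyondNbr {e} {k} eb ke k≢i₀ k≢b with z ~? to k
        ... | yes zk = star k≢i₀ zk k≢b λ kb → Δ-free ke kb eb
        -- With `d` as `i₀`, `z` sees `e`, `b` and `i₀` but not `k`, which would force `i₀` to be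
        -- adjacent to `b`.
        ... | no ¬zk = edgeTraceStar φd bull house Δ-free ke (off td e≢i₀ (star⁻ eb))
                         (λ zk → ¬zk (off⁻ td k≢i₀ zk)) prI eb (off td b≢i₀ zb) (at td zd) (b≢i₀ ∘ sym)
                         (¬bi₀ ∘ I.~-sym)
          where
          e≢i₀ : e ≢ i₀
          e≢i₀ refl = ¬bi₀ (I.~-sym eb)

        beyondHood : ∀ {j k} → j I.~ i₀ → j I.~ k → k ≢ i₀ → k ≢ b → ⊥
        beyondHood {j} {k} ji₀ jk k≢i₀ k≢b =
          star (I.~⇒≢ ji₀) (z~nbr ji₀ jk k≢i₀) (λ { refl → ¬bi₀ ji₀ }) λ jb →
            beyondNbr jb (I.~-sym jk) k≢i₀ k≢b

        S : I.V → Set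
        S x = (x ≡ i₀ ⊎ x ≡ b) ⊎ (x I.~ i₀ ⊎ x I.~ b)

        S-closed : ∀ {x y} → x I.~ y → S x → ¬ S y → ⊥
        S-closed xy (inj₁ (inj₁ refl)) ¬Sy = ¬Sy (inj₂ (inj₁ (I.~-sym xy)))
        S-closed xy (inj₁ (inj₂ refl)) ¬Sy = ¬Sy (inj₂ (inj₂ (I.~-sym xy)))
        S-closed xy (inj₂ (inj₁ xi₀))  ¬Sy = beyondHood xi₀ xy (¬Sy ∘ inj₁ ∘ inj₁) (¬Sy ∘ inj₁ ∘ inj₂)
        S-closed xy (inj₂ (inj₂ xb))   ¬Sy = beyondNbr xb (I.~-sym xy) (¬Sy ∘ inj₁ ∘ inj₁) (¬Sy ∘ inj₁ ∘ inj₂)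

        inside : ∀ {x y} → x I.~ y → x ≡ i₀ ⊎ x ≡ b → y ≡ i₀ ⊎ y ≡ b → ⊥
        inside xy (inj₁ refl) (inj₁ refl) = I.~-irr xy
        inside xy (inj₁ refl) (inj₂ refl) = ¬bi₀ (I.~-sym xy)
        inside xy (inj₂ refl) (inj₁ refl) = ¬bi₀ xy
        inside xy (inj₂ refl) (inj₂ refl) = I.~-irr xy

        outside : ∀ {x y} → x I.~ y → ¬ (x ≡ i₀ ⊎ x ≡ b) → ¬ (y ≡ i₀ ⊎ y ≡ b) → ⊥
        outside xy ¬x ¬y = connI S S-closed {i₀} (inj₁ (inj₁ refl)) λ where
          (inj₁ x∈)        → ¬x x∈
          (inj₂ (inj₁ xi₀)) → beyondHood xi₀ xy (¬y ∘ inj₁) (¬y ∘ inj₂)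
          (inj₂ (inj₂ xb))  → beyondNbr xb (I.~-sym xy) (¬y ∘ inj₁) (¬y ∘ inj₂)

    -- By `twinsUnmixed`, a vertex splitting an edge between twins of `i₀` is a twin as well, so a
    -- component of the twins is a module of `G`. It avoids the neighbours of `i₀` in `I`.
    noAdjacentTwin : ∀ {i₀ p} → TwinOf i₀ p → ¬ to i₀ ~ p
    noAdjacentTwin {i₀} tp i₀p = pathFrom i₀ λ {q} qi₀ _ _ →
      componentModule G prG (TwinOf i₀) {c = to q}
        (λ _ → ~⁻ , ~⁺) tp i₀p (λ tq → I.~-irr (~⁻ (proj₂ (tq (I.~⇒≢ qi₀)) (I.~-sym qi₀))))
        (λ ¬tz td td′ dd′ zd ¬zd′ → twinsUnmixed td td′ dd′ zd ¬zd′ ¬tz)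

    -- On the way from a seen edge to a missed vertex there is a seen edge `e e′` such that `e` has
    -- a missed neighbour `b`. Then `r` is an adjacent twin of `e′`.
    mixedTraceStable : ∀ {r} → ¬ (∀ i → r ~ to i) → ∀ {a b} → a I.~ b → r ~ to a → r ~ to b → ⊥
    mixedTraceStable {r} incomplete {a} {b} ab ra rb = incomplete λ i → ~-stable λ ¬ri →
      connI P P-cut {a} {i} (ra , b , ab , rb) (¬ri ∘ proj₁)
      where
      P : I.V → Set
      P f = r ~ to f × ∃ λ g → f I.~ g × r ~ to g
      P-cut : ∀ {e b} → e I.~ b → P e → ¬ P b → ⊥
      P-cut {e} {b} eb (re , e′ , ee′ , re′) ¬Pb = noAdjacentTwin twin (~-sym re′)
        where
        ¬rb : ¬ r ~ to b
        ¬rb rb = ¬Pb (rb , e , I.~-sym eb , re)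
        twin : TwinOf e′ r
        twin j≢e′ =
            (λ rj → I.~-stable λ ¬e′j → edgeTraceStar φ bull house Δ-free (I.~-sym eb) re ¬rb prI ee′ re′ rj j≢e′
                      (I.≁-sym ¬e′j))
          , (λ e′j → edgeTrace⊇ φ bull house Δ-free (I.~-sym eb) re ¬rb ee′ re′ (I.~-sym e′j))

    -- On the triangle `s x y`, a vertex `c` seen only by `x` and the neighbour `b` of `s` are the
    -- pendants of a bull, or `y` is the roof of the square `s x c b`.
    sharedTrace : ∀ {x y s b} → (∀ {i j} → i I.~ j → x ~ to i → x ~ to j → ⊥) →
      (∀ {i j} → i I.~ j → y ~ to i → y ~ to j → ⊥) → x ~ y → x ~ to s → y ~ to s → s I.~ b →
      ∀ {c} → x ~ to c → y ~ to c
    sharedTrace {x} {y} {s} {b} x-stable y-stable xy xs ys sb {c} xc = ~-stable λ ¬yc → clash ¬yc (c I.~? b)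
      where
      ¬xb = x-stable sb xs
      ¬yb = y-stable sb ys
      ¬sc : ¬ s I.~ c
      ¬sc sc = x-stable sc xs xc
      clash : ¬ y ~ to c → Dec (c I.~ b) → ⊥
      clash ¬yc (no ¬cb) = bull xs xy (~-sym ys) xc (~⁺ sb) ¬yc ¬yb ¬xb (≁⁺ ¬sc) (≁⁺ ¬cb)
      clash ¬yc (yes cb) = house (~-sym xs) xc (~⁺ cb) (~⁺ (I.~-sym sb)) ys (~-sym xy) (≁⁺ ¬sc) ¬xb ¬yc ¬yb

module _ {I G : Gr} (φ : I ↪ G) where
  private module I = Gr I
  open Gr G
  open _↪_ φ

  -- Connectedness of `G` supplies an anticentre with a neighbour `u` that sees some `s` in `I`.
  -- Every vertex of `G` lies in a triangle, so `u` is not isolated in the neighbourhood of `s`; yet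
  -- its component there stays within `Similar` and so misses the neighbours of `s` in `I`.
  houseAnti : Prime → BullFree → HouseFree → I.Prime → I.NonBipartite →
              ∀ {v x y} → v ~ x → v ~ y → x ~ y → (∀ i → ¬ to i ~ v) → ⊥
  houseAnti prG bull house prI nbI {v} {x} {y} vx vy xy anti =
    nbI (λ _ → ⊤) (λ ij _ _ → fromEdge ij) (λ _ ¬⊤ _ → ¬⊤ tt)
    where
    connI   = I.prime⇒connected prI nbI
    coconnI = I.prime⇒coconnected prI nbI
    connG   = prime⇒connected prG (triangle⇒nonBipartite vx vy xy)

    everyTriangle : ∀ p → ¬ NoTriangleAt p
    everyTriangle p ¬Δ = connG NoTriangleAt
      (λ xy ¬Δx ¬¬Δy → ¬¬Δy (noTriangleSpreads (id↪ {G}) prG bull house xy ¬Δx)) {p} {v} ¬Δ (λ ¬Δv → ¬Δv vx vy xy)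

    Anti : V → Set
    Anti p = ∀ i → ¬ to i ~ p

    fromEdge : ∀ {i₀ j₀} → i₀ I.~ j₀ → ⊥
    fromEdge {i₀} {j₀} i₀j₀ = connG Anti
      (λ {v′} {u} v′u anti′ ¬anti → ¬anti λ s su → fromAttachment (~-sym v′u) anti′ (~-sym su))
      {v} {to i₀} anti (λ a → a j₀ (~⁺ (I.~-sym i₀j₀)))
      where
      fromAttachment : ∀ {u v s} → u ~ v → (∀ i → ¬ to i ~ v) → u ~ to s → ⊥
      fromAttachment {u} {v} {s} uv anti us =
        everyTriangle (to s) λ sb sc bc → hoodNotIsolated (id↪ {G}) prG bull house us withCommonNeighbour sb sc bc
        where
        u-stable : ∀ {i j} → i I.~ j → u ~ to i → u ~ to j → ⊥
        u-stable = adjacentTrace φ prG bull (inj₁ house) prI nbI uv anti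

        Δ-free : ∀ {i} → I.NoTriangleAt i
        Δ-free {i} ij ik jk = connI (λ x → I.NoTriangleAt x)
          (λ xy ¬Δx ¬¬Δy → ¬¬Δy (noTriangleSpreads φ prI bull house xy ¬Δx)) {s} {i}
          (hoodNotIsolated φ prI bull house us (λ ys uy → u-stable ys uy us)) (λ ¬Δ → ¬Δ ij ik jk)

        Similar : V → Set
        Similar r = r ~ to s × r ~ v × (∀ {c} → r ~ to c → u ~ to c) × (∀ {c} → u ~ to c → r ~ to c)

        -- If `t` is complete to `I`, it is a centre next to `v`, or there is a bull on `r t s` with
        -- pendants `v` and a vertex missed by `u` and `s`. Otherwise its trace is stable, and the
        -- common vertex `s` makes it equal to that of `u`.
        Similar-closed : ∀ {b} → s I.~ b → ∀ {r t} → Similar r → r ~ t → t ~ to s → ¬ Similar t → ⊥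
        Similar-closed {b} sb {r} {t} (rs , rv , r⊆u , u⊆r) rt ts ¬t = ¬¬-excluded-middle λ where
            (yes complete) → centreClash complete (t ~? v)
            (no incomplete) → similarClash (mixedTraceStable φ prG bull house prI nbI Δ-free incomplete)
          where
          r-stable : ∀ {i j} → i I.~ j → r ~ to i → r ~ to j → ⊥
          r-stable ij ri rj = u-stable ij (r⊆u ri) (r⊆u rj)

          centreClash : (∀ i → t ~ to i) → Dec (t ~ v) → ⊥
          centreClash complete (yes tv) =
            noAdjacentCentreAnticentre φ prG bull (inj₁ house) connI coconnI i₀j₀ tv complete anti
          -- `u` misses an edge of `I`, and one of its ends is missed by `s` because `I` is
          -- triangle-free.
          centreClash complete (no ¬tv) = nbI (λ i → u ~ to i) u-stable λ {i} {j} ij ¬ui ¬uj →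
            awayFrom ij ¬ui ¬uj (i I.~? s)
            where
            bullAt : ∀ {f} → ¬ u ~ to f → ¬ f I.~ s → ⊥
            bullAt {f} ¬uf ¬fs = bull rt rs ts rv (complete f) (anti s) (≁⁺ (I.≁-sym ¬fs)) (¬uf ∘ r⊆u) ¬tv
                                   (≁-sym (anti f))
            awayFrom : ∀ {i j} → i I.~ j → ¬ u ~ to i → ¬ u ~ to j → Dec (i I.~ s) → ⊥
            awayFrom ij ¬ui ¬uj (no ¬is) = bullAt ¬ui ¬is
            awayFrom ij ¬ui ¬uj (yes is) = bullAt ¬uj λ js → Δ-free ij is js

          similarClash : (∀ {i j} → i I.~ j → t ~ to i → t ~ to j → ⊥) → ⊥
          similarClash t-stable = ¬t (ts , tv , t⊆u , u⊆t)
            where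
            tv : t ~ v
            tv = ~-stable λ ¬tv → bull rs rt (~-sym ts) rv (~⁺ sb) ¬tv (t-stable sb ts) (r-stable sb rs) (anti s)
                                    (≁-sym (anti b))
            t⊆u : ∀ {c} → t ~ to c → u ~ to c
            t⊆u tc = r⊆u (sharedTrace φ prG bull house prI nbI Δ-free t-stable r-stable (~-sym rt) ts rs sb tc)
            u⊆t : ∀ {c} → u ~ to c → t ~ to c
            u⊆t uc = sharedTrace φ prG bull house prI nbI Δ-free r-stable t-stable rt rs ts sb (u⊆r uc)

        withCommonNeighbour : ∀ {h} → h ~ to s → ¬ u ~ h
        withCommonNeighbour hs uh = pathFrom φ prG bull house prI nbI Δ-free s λ {b} bs _ _ →
          hoodConnected (id↪ {G}) prG bull house (~⁺ bs) Similar (Similar-closed (I.~-sym bs))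
            (λ { (_ , _ , r⊆u , _) br → u-stable bs (r⊆u (~-sym br)) us })
            (us , uv , id , id) us hs uh

-- Without diamonds: two matched maximal cliques

module _ (G : Gr) where
  open Gr G

  record Line (K : V → Set) : Set where
    field
      clique  : ∀ {x y} → K x → K y → x ≢ y → x ~ y
      closed : ∀ {x k k′} → K k → K k′ → k ≢ k′ → x ~ k → x ~ k′ → K x

  -- In a diamond-free graph every edge lies in exactly one maximal clique.
  line : DiamondFree → ∀ {a b} → a ~ b → Line (λ x → (x ≡ a ⊎ x ≡ b) ⊎ (x ~ a × x ~ b))
  line diamond {a} {b} ab = record { clique = clique ; closed = closed }
    where
    K : V → Set
    K x = (x ≡ a ⊎ x ≡ b) ⊎ (x ~ a × x ~ b)
    clique : ∀ {x y} → K x → K y → x ≢ y → x ~ y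
    clique (inj₁ (inj₁ refl)) (inj₁ (inj₁ refl)) x≢y = contradiction refl x≢y
    clique (inj₁ (inj₁ refl)) (inj₁ (inj₂ refl)) _ = ab
    clique (inj₁ (inj₂ refl)) (inj₁ (inj₁ refl)) _ = ~-sym ab
    clique (inj₁ (inj₂ refl)) (inj₁ (inj₂ refl)) x≢y = contradiction refl x≢y
    clique (inj₁ (inj₁ refl)) (inj₂ (ya , _)) _ = ~-sym ya
    clique (inj₁ (inj₂ refl)) (inj₂ (_ , yb)) _ = ~-sym yb
    clique (inj₂ (xa , _)) (inj₁ (inj₁ refl)) _ = xa
    clique (inj₂ (_ , xb)) (inj₁ (inj₂ refl)) _ = xb
    clique (inj₂ (xa , xb)) (inj₂ (ya , yb)) x≢y = ~-stable (diamond ab xa xb ya yb x≢y)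
    adjacent-to : ∀ {x k k′ c} → K k → K k′ → k ≢ k′ → x ~ k → x ~ k′ → K c → x ≢ c → x ~ c
    adjacent-to {x} {k} {k′} {c} Kk Kk′ k≢k′ xk xk′ Kc x≢c with c ≟ k | c ≟ k′
    ... | yes refl | _ = xk
    ... | no _ | yes refl = xk′
    ... | no c≢k | no c≢k′ =
      ~-stable (diamond (clique Kk Kk′ k≢k′) xk xk′ (clique Kc Kk c≢k) (clique Kc Kk′ c≢k′) x≢c)
    closed : ∀ {x k k′} → K k → K k′ → k ≢ k′ → x ~ k → x ~ k′ → K x
    closed {x} Kk Kk′ k≢k′ xk xk′ with x ≟ a | x ≟ b
    ... | yes x≡a | _ = inj₁ (inj₁ x≡a)
    ... | no _ | yes x≡b = inj₁ (inj₂ x≡b)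
    ... | no x≢a | no x≢b = inj₂ ( adjacent-to Kk Kk′ k≢k′ xk xk′ (inj₁ (inj₁ refl)) x≢a
                                 , adjacent-to Kk Kk′ k≢k′ xk xk′ (inj₁ (inj₂ refl)) x≢b)

  module _ {K : V → Set} (LK : Line K) where
    open Line LK

    oneNeighbour : ∀ {x k k′} → ¬ K x → K k → K k′ → k ≢ k′ → x ~ k → ¬ x ~ k′
    oneNeighbour ¬Kx Kk Kk′ k≢k′ xk xk′ = ¬Kx (closed Kk Kk′ k≢k′ xk xk′)

    -- Each of `p`, `q` sees only one vertex of `K`, so if nonadjacent they would be the pendants of
    -- a bull on `k l m`.
    attachmentsAdjacent : BullFree → ∀ {k l m p q} → K k → K l → K m → k ≢ l → k ≢ m → l ≢ m →
                          ¬ K p → ¬ K q → p ~ k → q ~ l → p ~ q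
    attachmentsAdjacent bull Kk Kl Km k≢l k≢m l≢m ¬Kp ¬Kq pk ql = ~-stable λ ¬pq →
      bull (clique Kk Kl k≢l) (clique Kk Km k≢m) (clique Kl Km l≢m) (~-sym pk) (~-sym ql)
        (≁-sym (oneNeighbour ¬Kp Kk Km k≢m pk)) (≁-sym (oneNeighbour ¬Kq Kl Km l≢m ql))
        (≁-sym (oneNeighbour ¬Kq Kl Kk (k≢l ∘ sym) ql)) (≁-sym (oneNeighbour ¬Kp Kk Kl k≢l pk)) ¬pq

  -- Three disjoint edges between the cliques, so that two are left when one end is excluded.
  record Matched (K L : V → Set) : Set where
    field
      {k₁ k₂ k₃ p₁ p₂ p₃} : V
      K₁ : K k₁
      K₂ : K k₂
      K₃ : K k₃
      L₁ : L p₁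
      L₂ : L p₂
      L₃ : L p₃
      ¬L₁ : ¬ L k₁
      ¬L₂ : ¬ L k₂
      ¬L₃ : ¬ L k₃
      ¬K₁ : ¬ K p₁
      ¬K₂ : ¬ K p₂
      ¬K₃ : ¬ K p₃
      k₁≢k₂ : k₁ ≢ k₂
      k₁≢k₃ : k₁ ≢ k₃
      k₂≢k₃ : k₂ ≢ k₃
      p₁≢p₂ : p₁ ≢ p₂
      p₁≢p₃ : p₁ ≢ p₃
      p₂≢p₃ : p₂ ≢ p₃
      p₁k₁ : p₁ ~ k₁
      p₂k₂ : p₂ ~ k₂
      p₃k₃ : p₃ ~ k₃

  swapMatched : ∀ {K L} → Matched K L → Matched L K
  swapMatched M = record
    { K₁ = L₁ ; K₂ = L₂ ; K₃ = L₃ ; L₁ = K₁ ; L₂ = K₂ ; L₃ = K₃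
    ; ¬L₁ = ¬K₁ ; ¬L₂ = ¬K₂ ; ¬L₃ = ¬K₃ ; ¬K₁ = ¬L₁ ; ¬K₂ = ¬L₂ ; ¬K₃ = ¬L₃
    ; k₁≢k₂ = p₁≢p₂ ; k₁≢k₃ = p₁≢p₃ ; k₂≢k₃ = p₂≢p₃ ; p₁≢p₂ = k₁≢k₂ ; p₁≢p₃ = k₁≢k₃ ; p₂≢p₃ = k₂≢k₃
    ; p₁k₁ = ~-sym p₁k₁ ; p₂k₂ = ~-sym p₂k₂ ; p₃k₃ = ~-sym p₃k₃ }
    where open Matched M

  -- Two of `k₁`, `k₂`, `k₃` differ from `k`. Their partners in `L` are adjacent to `r`, and two
  -- neighbours in a line put `r` on it.
  leaveMatched : BullFree → ∀ {K L} → Line K → Line L → Matched K L → ∀ {k r} → K k → r ~ k → ¬ K r → L r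
  leaveMatched bull {K} {L} LK LL M {k} {r} Kk rk ¬Kr with k ≟ k₁ | k ≟ k₂
    where open Matched M
  ... | yes refl | _ = Line.closed LL L₂ L₃ p₂≢p₃
          (attachmentsAdjacent LK bull Kk K₂ K₃ k₁≢k₂ k₁≢k₃ k₂≢k₃ ¬Kr ¬K₂ rk p₂k₂)
          (attachmentsAdjacent LK bull Kk K₃ K₂ k₁≢k₃ k₁≢k₂ (k₂≢k₃ ∘ sym) ¬Kr ¬K₃ rk p₃k₃)
    where open Matched M
  ... | no k≢k₁ | yes refl = Line.closed LL L₁ L₃ p₁≢p₃
          (attachmentsAdjacent LK bull Kk K₁ K₃ k≢k₁ k₂≢k₃ k₁≢k₃ ¬Kr ¬K₁ rk p₁k₁)
          (attachmentsAdjacent LK bull Kk K₃ K₁ k₂≢k₃ k≢k₁ (k₁≢k₃ ∘ sym) ¬Kr ¬K₃ rk p₃k₃)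
    where open Matched M
  ... | no k≢k₁ | no k≢k₂ = Line.closed LL L₁ L₂ p₁≢p₂
          (attachmentsAdjacent LK bull Kk K₁ K₂ k≢k₁ k≢k₂ k₁≢k₂ ¬Kr ¬K₁ rk p₁k₁)
          (attachmentsAdjacent LK bull Kk K₂ K₁ k≢k₂ k≢k₁ (k₁≢k₂ ∘ sym) ¬Kr ¬K₂ rk p₂k₂)
    where open Matched M

module _ {I G : Gr} (φ : I ↪ G) where
  private module I = Gr I
  open Gr G
  open _↪_ φ

  -- Let `K` be the maximal clique on `ab`. Three of its vertices with neighbours outside `K`
  -- produce a second clique matched to `K`, and connectedness leaves room for nothing else. If `K`
  -- is just the triangle, fatness gives these neighbours; if it has a fourth vertex, primality lets
  -- at most one vertex of `K` lack them.
  diamondAnti : Prime → BullFree → DiamondFree → I.Prime → I.NonBipartite → (∀ {i j} → to i ≡ to j → i ≡ j) →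
                ∀ {a b c p q r} → a ~ b → a ~ c → b ~ c →
                p ~ a → p ≢ b → p ≢ c → q ~ b → q ≢ a → q ≢ c → r ~ c → r ≢ a → r ≢ b →
                (∀ i → ¬ to i ~ a) → ⊥
  diamondAnti prG bull diamond prI nbI injective {a} {b} {c} {p} {q} {r} ab ac bc pa p≢b p≢c qb q≢a q≢c rc r≢a r≢b anti =
    ¬¬-excluded-middle {A = ∃ λ d → K d × d ≢ a × d ≢ b × d ≢ c} λ where
      (yes (d , Kd , d≢a , d≢b , d≢c)) → fourth Kd d≢a d≢b d≢c
      (no none) → threePrivate Ka Kb Kc a≢b a≢c b≢c
        (p , pa , λ Kp → none (p , Kp , ~⇒≢ pa , p≢b , p≢c))
        (q , qb , λ Kq → none (q , Kq , q≢a , ~⇒≢ qb , q≢c))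
        (r , rc , λ Kr → none (r , Kr , r≢a , r≢b , ~⇒≢ rc))
    where
    a≢b = ~⇒≢ ab
    a≢c = ~⇒≢ ac
    b≢c = ~⇒≢ bc

    K : V → Set
    K x = (x ≡ a ⊎ x ≡ b) ⊎ (x ~ a × x ~ b)
    Ka : K a
    Ka = inj₁ (inj₁ refl)
    Kb : K b
    Kb = inj₁ (inj₂ refl)
    Kc : K c
    Kc = inj₂ (~-sym ac , ~-sym bc)
    LK : Line G K
    LK = line G diamond ab
    open Line LK

    Private : V → Set
    Private k = ∃ λ p → p ~ k × ¬ K p

    -- A vertex of `I` outside `L` lies in `K`, hence is `a` itself and isolated in `I`. So `I` is a
    -- clique with isolated vertices, and the ends of any edge form a module, proper since `I` has a
    -- third vertex.
    twoCliques : ∀ {L} → Line G L → (∀ x → ¬ ¬ (K x ⊎ L x)) → ⊥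
    twoCliques {L} LL cover = nbI (L ∘ to) inside λ {i} {j} ij ¬Li _ → anti j (≡a-subst (K⇒≡a i (notL ¬Li)) ij)
      where
      notL : ∀ {i} → ¬ L (to i) → ¬ ¬ K (to i)
      notL {i} ¬Li ¬Ki = cover (to i) λ where
        (inj₁ Ki) → ¬Ki Ki
        (inj₂ Li) → ¬Li Li
      K⇒≡a : ∀ i → ¬ ¬ K (to i) → to i ≡ a
      K⇒≡a i ¬¬Ki = decidable-stable (to i ≟ a) λ i≢a → ¬¬Ki λ Ki → anti i (clique Ki Ka i≢a)
      ≡a-subst : ∀ {i j} → to i ≡ a → i I.~ j → to j ~ a
      ≡a-subst i≡a ij = subst (_ ~_) i≡a (~⁺ (I.~-sym ij))

      inside : ∀ {i j} → i I.~ j → L (to i) → L (to j) → ⊥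
      inside {i} {j} ij Li Lj = nbI (_≡ i) (λ { xy refl refl → I.~-irr xy }) third
        where
        noThird : ∀ {x} → x ≢ i → x ≢ j → ⊥
        noThird x≢i x≢j = prI (λ z → z ≡ i ⊎ z ≡ j) (I.~⇒≢ ij) (inj₁ refl) (inj₂ refl)
          (λ { (inj₁ x≡i) → x≢i x≡i ; (inj₂ x≡j) → x≢j x≡j }) unmixed
          where
          adjacent : ∀ {z k l} → L (to l) → z ≢ l → z I.~ k → ¬ z I.~ l → ⊥
          adjacent {z} Ll z≢l zk ¬zl = anti _ (≡a-subst (K⇒≡a z (notL λ Lz →
            ¬zl (~⁻ (Line.clique LL Lz Ll (z≢l ∘ injective))))) zk)
          unmixed : I.Unmixed (λ z → z ≡ i ⊎ z ≡ j)
          unmixed ¬z _ (inj₁ refl) zx ¬zy = adjacent Li (¬z ∘ inj₁) zx ¬zy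
          unmixed ¬z _ (inj₂ refl) zx ¬zy = adjacent Lj (¬z ∘ inj₂) zx ¬zy
        third : ∀ {x y} → x I.~ y → x ≢ i → y ≢ i → ⊥
        third {x} xy x≢i y≢i with x I.≟ j
        ... | no x≢j   = noThird x≢i x≢j
        ... | yes refl = noThird y≢i (I.~⇒≢ (I.~-sym xy))

    threePrivate : ∀ {k l m} → K k → K l → K m → k ≢ l → k ≢ m → l ≢ m → Private k → Private l → Private m → ⊥
    threePrivate {k} {l} {m} Kk Kl Km k≢l k≢m l≢m (p₁ , p₁k , ¬Kp₁) (p₂ , p₂l , ¬Kp₂) (p₃ , p₃m , ¬Kp₃) =
      twoCliques LL λ x ¬x → prime⇒connected prG (triangle⇒nonBipartite ab ac bc) (λ x → K x ⊎ L x) closed′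
        {a} {x} (inj₁ Ka) ¬x
      where
      p₁p₂ = attachmentsAdjacent G LK bull Kk Kl Km k≢l k≢m l≢m ¬Kp₁ ¬Kp₂ p₁k p₂l
      p₁p₃ = attachmentsAdjacent G LK bull Kk Km Kl k≢m k≢l (l≢m ∘ sym) ¬Kp₁ ¬Kp₃ p₁k p₃m
      p₂p₃ = attachmentsAdjacent G LK bull Kl Km Kk l≢m (k≢l ∘ sym) (k≢m ∘ sym) ¬Kp₂ ¬Kp₃ p₂l p₃m
      L : V → Set
      L x = (x ≡ p₁ ⊎ x ≡ p₂) ⊎ (x ~ p₁ × x ~ p₂)
      LL : Line G L
      LL = line G diamond p₁p₂
      disjoint : ∀ {x} → K x → ¬ L x
      disjoint Kx (inj₁ (inj₁ refl)) = ¬Kp₁ Kx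
      disjoint Kx (inj₁ (inj₂ refl)) = ¬Kp₂ Kx
      disjoint {x} Kx (inj₂ (xp₁ , xp₂)) with x ≟ k
      ... | yes refl = oneNeighbour G LK ¬Kp₂ Kl Kx (k≢l ∘ sym) p₂l (~-sym xp₂)
      ... | no x≢k   = oneNeighbour G LK ¬Kp₁ Kk Kx (x≢k ∘ sym) p₁k (~-sym xp₁)
      M : Matched G K L
      M = record
        { K₁ = Kk ; K₂ = Kl ; K₃ = Km
        ; L₁ = inj₁ (inj₁ refl) ; L₂ = inj₁ (inj₂ refl) ; L₃ = inj₂ (~-sym p₁p₃ , ~-sym p₂p₃)
        ; ¬L₁ = disjoint Kk ; ¬L₂ = disjoint Kl ; ¬L₃ = disjoint Km ; ¬K₁ = ¬Kp₁ ; ¬K₂ = ¬Kp₂ ; ¬K₃ = ¬Kp₃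
        ; k₁≢k₂ = k≢l ; k₁≢k₃ = k≢m ; k₂≢k₃ = l≢m
        ; p₁≢p₂ = ~⇒≢ p₁p₂ ; p₁≢p₃ = ~⇒≢ p₁p₃ ; p₂≢p₃ = ~⇒≢ p₂p₃
        ; p₁k₁ = p₁k ; p₂k₂ = p₂l ; p₃k₃ = p₃m }
      closed′ : ∀ {x y} → x ~ y → K x ⊎ L x → ¬ (K y ⊎ L y) → ⊥
      closed′ xy (inj₁ Kx) ¬y = ¬y (inj₂ (leaveMatched G bull LK LL M Kx (~-sym xy) (¬y ∘ inj₁)))
      closed′ xy (inj₂ Lx) ¬y = ¬y (inj₁ (leaveMatched G bull LL LK (swapMatched G M) Lx (~-sym xy) (¬y ∘ inj₂)))

    separated : ∀ {k l m} → K k → K l → K m → k ≢ l → k ≢ m → l ≢ m → ¬ Private k → ¬ ¬ Private l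
    separated {k} {l} {m} Kk Kl Km k≢l k≢m l≢m ¬k ¬l = prG (λ x → x ≡ k ⊎ x ≡ l) k≢l (inj₁ refl) (inj₂ refl)
      (λ { (inj₁ m≡k) → k≢m (sym m≡k) ; (inj₂ m≡l) → l≢m (sym m≡l) }) unmixed
      where
      mixed : ∀ {z x y} → ¬ Private x → K y → z ≢ y → z ~ x → ¬ z ~ y → ⊥
      mixed {z} ¬x Ky z≢y zx ¬zy = ¬x (z , zx , λ Kz → ¬zy (clique Kz Ky z≢y))
      unmixed : Unmixed (λ x → x ≡ k ⊎ x ≡ l)
      unmixed ¬z (inj₁ refl) (inj₁ refl) zx ¬zy = ¬zy zx
      unmixed ¬z (inj₁ refl) (inj₂ refl) zx ¬zy = mixed ¬k Kl (¬z ∘ inj₂) zx ¬zy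
      unmixed ¬z (inj₂ refl) (inj₁ refl) zx ¬zy = mixed ¬l Kk (¬z ∘ inj₁) zx ¬zy
      unmixed ¬z (inj₂ refl) (inj₂ refl) zx ¬zy = ¬zy zx

    oneLacking : ∀ {x k l m} → K x → K k → K l → K m → x ≢ k → x ≢ l → x ≢ m → k ≢ l → k ≢ m → l ≢ m →
                 ¬ Private x → ⊥
    oneLacking Kx Kk Kl Km x≢k x≢l x≢m k≢l k≢m l≢m ¬x =
      separated Kx Kk Kl x≢k x≢l k≢l ¬x λ Pk →
      separated Kx Kl Kk x≢l x≢k (k≢l ∘ sym) ¬x λ Pl →
      separated Kx Km Kk x≢m x≢k (k≢m ∘ sym) ¬x λ Pm →
      threePrivate Kk Kl Km k≢l k≢m l≢m Pk Pl Pm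

    fourth : ∀ {d} → K d → d ≢ a → d ≢ b → d ≢ c → ⊥
    fourth Kd d≢a d≢b d≢c =
      oneLacking Ka Kb Kc Kd a≢b a≢c (d≢a ∘ sym) b≢c (d≢b ∘ sym) (d≢c ∘ sym) λ Pa →
      oneLacking Kb Ka Kc Kd (a≢b ∘ sym) b≢c (d≢b ∘ sym) a≢c (d≢a ∘ sym) (d≢c ∘ sym) λ Pb →
      oneLacking Kc Ka Kb Kd (a≢c ∘ sym) (b≢c ∘ sym) (d≢c ∘ sym) a≢b (d≢a ∘ sym) (d≢b ∘ sym) λ Pc →
      threePrivate Ka Kb Kc a≢b a≢c b≢c Pa Pb Pc

-- Subsets, weights and substitution into weight-perfect graphs

Sub : ℕ → Set
Sub n = Fin n → Bool

infix 4 _∈_ _∉_ _⊆_ _∈?_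
_∈_ _∉_ : ∀ {n} → Fin n → Sub n → Set
i ∈ S = S i ≡ true
i ∉ S = ¬ i ∈ S

_⊆_ : ∀ {n} → Sub n → Sub n → Set
S ⊆ T = ∀ {i} → i ∈ S → i ∈ T

_∈?_ : ∀ {n} (i : Fin n) (S : Sub n) → Dec (i ∈ S)
i ∈? S = S i Bool.≟ true

comprehension : ∀ {n} {P : Fin n → Set} → (∀ i → Dec (P i)) → Sub n
comprehension P? i = does (P? i)

module _ {n} {P : Fin n → Set} (P? : ∀ i → Dec (P i)) where
  ∈-comprehension⁺ : ∀ {i} → P i → i ∈ comprehension P?
  ∈-comprehension⁺ {i} = dec-true (P? i)

  ∈-comprehension⁻ : ∀ {i} → i ∈ comprehension P? → P i
  ∈-comprehension⁻ {i} i∈ with P? i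
  ... | yes p = p

infixr 6 _∪_
infixr 7 _∩_ _∖_
_∪_ _∩_ _∖_ : ∀ {n} → Sub n → Sub n → Sub n
(S ∪ T) i = S i ∨ T i
(S ∩ T) i = S i ∧ T i
(S ∖ T) i = S i ∧ not (T i)

⁅_⁆ : ∀ {n} → Fin n → Sub n
⁅ x ⁆ i = does (i Fin.≟ x)

module _ {n} {S T : Sub n} {i : Fin n} where
  ∪⁺ˡ : i ∈ S → i ∈ S ∪ T
  ∪⁺ˡ i∈S rewrite i∈S = refl

  ∪⁺ʳ : i ∈ T → i ∈ S ∪ T
  ∪⁺ʳ i∈T rewrite i∈T = ∨-zeroʳ (S i)

  ∪⁻ : i ∈ S ∪ T → i ∈ S ⊎ i ∈ T
  ∪⁻ i∈ with S i
  ... | true  = inj₁ refl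
  ... | false = inj₂ i∈

  ∩⁺ : i ∈ S → i ∈ T → i ∈ S ∩ T
  ∩⁺ i∈S i∈T rewrite i∈S = i∈T

  ∩⁻ : i ∈ S ∩ T → i ∈ S × i ∈ T
  ∩⁻ i∈ with S i
  ... | true = refl , i∈

  ∖⁺ : i ∈ S → i ∉ T → i ∈ S ∖ T
  ∖⁺ i∈S i∉T rewrite i∈S with T i
  ... | true  = contradiction refl i∉T
  ... | false = refl

  ∖⁻ : i ∈ S ∖ T → i ∈ S × i ∉ T
  ∖⁻ i∈ with S i | T i
  ... | true | false = refl , λ ()

⁅⁆⁺ : ∀ {n} (x : Fin n) → x ∈ ⁅ x ⁆
⁅⁆⁺ x = dec-true (x Fin.≟ x) refl

⁅⁆⁻ : ∀ {n} {x i : Fin n} → i ∈ ⁅ x ⁆ → i ≡ x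
⁅⁆⁻ {x = x} = ∈-comprehension⁻ (Fin._≟ x)

sum-mono-≤ : ∀ {n} {f g : Fin n → ℕ} → (∀ i → f i ≤ g i) → sum f ≤ sum g
sum-mono-≤ {zero}  f≤g = z≤n
sum-mono-≤ {suc n} f≤g = +-mono-≤ (f≤g zero) (sum-mono-≤ (f≤g ∘ suc))

sum-mono-< : ∀ {n} {f g : Fin n → ℕ} → (∀ i → f i ≤ g i) → ∀ {j} → f j < g j → sum f < sum g
sum-mono-< f≤g {zero}  lt = +-mono-<-≤ lt (sum-mono-≤ (f≤g ∘ suc))
sum-mono-< f≤g {suc j} lt = +-mono-≤-< (f≤g zero) (sum-mono-< (f≤g ∘ suc) lt)

infix 8 _↾_
_↾_ : ∀ {n} → (Fin n → ℕ) → Sub n → Fin n → ℕ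
(w ↾ K) i = if K i then w i else 0

weight : ∀ {n} → (Fin n → ℕ) → Sub n → ℕ
weight w K = sum (w ↾ K)

size : ∀ {n} → Sub n → ℕ
size = weight (λ _ → 1)

module _ {n} {w w′ : Fin n → ℕ} {K L : Sub n} where
  ↾-≤ : K ⊆ L → (∀ {i} → i ∈ K → w i ≤ w′ i) → ∀ i → (w ↾ K) i ≤ (w′ ↾ L) i
  ↾-≤ K⊆L w≤w′ i with K i in i∈K
  ... | false = z≤n
  ... | true rewrite K⊆L i∈K = w≤w′ i∈K

  weight-≤ : K ⊆ L → (∀ {i} → i ∈ K → w i ≤ w′ i) → weight w K ≤ weight w′ L
  weight-≤ K⊆L w≤w′ = sum-mono-≤ (↾-≤ K⊆L w≤w′)

module _ {n} (w : Fin n → ℕ) where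
  ↾-∈ : ∀ {K i} → i ∈ K → (w ↾ K) i ≡ w i
  ↾-∈ i∈K rewrite i∈K = refl

  ↾-∉ : ∀ {K i} → i ∉ K → (w ↾ K) i ≡ 0
  ↾-∉ {K} {i} i∉K with K i
  ... | true  = contradiction refl i∉K
  ... | false = refl

  weight-⊆ : ∀ {K L} → K ⊆ L → weight w K ≤ weight w L
  weight-⊆ {K} {L} K⊆L = weight-≤ {w = w} {w} {K} {L} K⊆L (λ _ → ≤-refl)

  weight-⊂ : ∀ {K L} → K ⊆ L → ∀ {j} → j ∈ L → j ∉ K → 0 < w j → weight w K < weight w L
  weight-⊂ {K} {L} K⊆L {j} j∈L j∉K 0<wj =
    sum-mono-< (↾-≤ {w = w} {w} {K} {L} K⊆L (λ _ → ≤-refl)) {j}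
      (subst₂ _<_ (sym (↾-∉ {K} j∉K)) (sym (↾-∈ {L} j∈L)) 0<wj)

  weight-cover : ∀ {K L M} → (∀ {i} → i ∈ K → i ∈ L ⊎ i ∈ M) → weight w K ≤ weight w L + weight w M
  weight-cover {K} {L} {M} cover = ≤-trans (sum-mono-≤ pointwise) (≤-reflexive (∑-distrib-+ (w ↾ L) (w ↾ M)))
    where
    pointwise : ∀ i → (w ↾ K) i ≤ (w ↾ L) i + (w ↾ M) i
    pointwise i with K i in i∈K
    ... | false = z≤n
    ... | true with cover i∈K
    ...   | inj₁ i∈L rewrite i∈L = m≤m+n (w i) _
    ...   | inj₂ i∈M rewrite i∈M = m≤n+m (w i) _

  weight-disjoint : ∀ {K L M} → L ⊆ K → M ⊆ K → (∀ {i} → i ∈ L → i ∉ M) → weight w L + weight w M ≤ weight w K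
  weight-disjoint {K} {L} {M} L⊆K M⊆K dis =
    ≤-trans (≤-reflexive (sym (∑-distrib-+ (w ↾ L) (w ↾ M)))) (sum-mono-≤ pointwise)
    where
    pointwise : ∀ i → (w ↾ L) i + (w ↾ M) i ≤ (w ↾ K) i
    pointwise i with L i in i∈L | M i in i∈M
    ... | true  | true  = contradiction i∈M (dis i∈L)
    ... | true  | false rewrite L⊆K i∈L = ≤-reflexive (+-identityʳ (w i))
    ... | false | true  rewrite M⊆K i∈M = ≤-refl
    ... | false | false = z≤n

sum-zero : ∀ {n} (f : Fin n → ℕ) → (∀ i → f i ≡ 0) → sum f ≡ 0
sum-zero {zero}  f f≡0 = refl
sum-zero {suc n} f f≡0 = cong₂ _+_ (f≡0 zero) (sum-zero (f ∘ suc) (f≡0 ∘ suc))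

weight-⁅⁆ : ∀ {n} (w : Fin n → ℕ) x → weight w ⁅ x ⁆ ≡ w x
weight-⁅⁆ {suc n} w zero = trans (cong (w zero +_) (sum-zero {n} _ λ _ → refl)) (+-identityʳ (w zero))
weight-⁅⁆ w (suc x) = weight-⁅⁆ (w ∘ suc) x

∈-tabulate⁺ : ∀ {n} {K : Sub n} {i} → i ∈ K → i ∈ lookup (tabulate K)
∈-tabulate⁺ {K = K} {i} = trans (lookup∘tabulate K i)

∈-tabulate⁻ : ∀ {n} {K : Sub n} {i} → i ∈ lookup (tabulate K) → i ∈ K
∈-tabulate⁻ {K = K} {i} = trans (sym (lookup∘tabulate K i))

size-⊆ : ∀ {n} (S T : Sub n) → S ⊆ T → size S ≤ size T
size-⊆ S T = weight-⊆ (λ _ → 1) {S} {T}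

-- m of the colours in T are renamed to 0, …, m − 1.
rename : ∀ {k} (T : Sub k) {m} → m ≤ size T → Σ (Fin k → Maybe (Fin m)) λ ρ →
         (∀ c {t} → ρ c ≡ just t → c ∈ T) × (∀ (f : Sub m) → size f ≤ size (λ c → maybe′ f false (ρ c)))
rename T {zero} _ = (λ _ → nothing) , (λ _ ()) , λ _ → z≤n
rename {zero} T {suc m} ()
rename {suc k} T {suc m} m≤T with T zero in T0
... | false with rename {k} (T ∘ suc) m≤T
...   | ρ , ρ-in , ρ-size = ρ′ , ρ′-in , ρ-size
  where
  ρ′ : Fin (suc k) → Maybe (Fin (suc m))
  ρ′ zero    = nothing
  ρ′ (suc c) = ρ c
  ρ′-in : ∀ c {t} → ρ′ c ≡ just t → c ∈ T
  ρ′-in zero ()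
  ρ′-in (suc c) = ρ-in c
rename {suc k} T {suc m} (s≤s m≤T) | true with rename {k} (T ∘ suc) m≤T
...   | ρ , ρ-in , ρ-size = ρ′ , ρ′-in , ρ′-size
  where
  ρ′ : Fin (suc k) → Maybe (Fin (suc m))
  ρ′ zero    = just zero
  ρ′ (suc c) = Maybe.map suc (ρ c)
  ρ′-in : ∀ c {t} → ρ′ c ≡ just t → c ∈ T
  ρ′-in zero _ = T0
  ρ′-in (suc c) eq with ρ c in ρc
  ... | just _ = ρ-in c ρc
  ρ′-size : ∀ f → size f ≤ size (λ c → maybe′ f false (ρ′ c))
  ρ′-size f = +-monoʳ-≤ (if f zero then 1 else 0)
    (≤-trans (ρ-size (f ∘ suc))
      (size-⊆ (λ c → maybe′ (f ∘ suc) false (ρ c)) (λ c → maybe′ f false (Maybe.map suc (ρ c))) λ {c} → shift c))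
    where
    shift : ∀ c → maybe′ (f ∘ suc) false (ρ c) ≡ true → maybe′ f false (Maybe.map suc (ρ c)) ≡ true
    shift c with ρ c
    ... | just _ = id

below above : ∀ k → ℕ → Sub k
below k a c = does (toℕ c <? a)
above k a c = does (a ≤? toℕ c)

size-below : ∀ k {a} → a ≤ k → a ≤ size (below k a)
size-below k       {zero}  _         = z≤n
size-below (suc k) {suc a} (s≤s a≤k) = s≤s (≤-trans (size-below k a≤k)
  (size-⊆ (below k a) (below (suc k) (suc a) ∘ suc) λ {c} c∈ →
    ∈-comprehension⁺ (λ c → suc (toℕ c) <? suc a) {c} (s≤s (∈-comprehension⁻ (λ c → toℕ c <? a) {c} c∈))))

size-above : ∀ k a → k ∸ a ≤ size (above k a)
size-above zero    a       = ≤-reflexive (0∸n≡0 a)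
size-above (suc k) zero    = s≤s (size-above k zero)
size-above (suc k) (suc a) = ≤-trans (size-above k a) (≤-trans
  (size-⊆ (above k a) (above (suc k) (suc a) ∘ suc) λ {c} c∈ →
    ∈-comprehension⁺ (λ c → suc a ≤? suc (toℕ c)) {c} (s≤s (∈-comprehension⁻ (λ c → a ≤? toℕ c) {c} c∈)))
  (m≤n+m _ _))

module _ {n} (G : Graph n) where

  infix 4 _∼_
  _∼_ : Fin n → Fin n → Set
  i ∼ j = adj G i j ≡ true

  ∼-sym : ∀ {i j} → i ∼ j → j ∼ i
  ∼-sym {i} {j} = trans (adj-sym G j i)

  ∼-irr : ∀ {i} → ¬ i ∼ i
  ∼-irr {i} ii with trans (sym ii) (adj-irr G i)
  ... | ()

  ∼⇒≢ : ∀ {i j} → i ∼ j → i ≢ j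
  ∼⇒≢ ij refl = ∼-irr ij

  Clique : Sub n → Set
  Clique K = ∀ {i j} → i ∈ K → j ∈ K → i ≢ j → i ∼ j

  clique-⊆ : ∀ {K L} → K ⊆ L → Clique L → Clique K
  clique-⊆ K⊆L cL i∈K j∈K = cL (K⊆L i∈K) (K⊆L j∈K)

  clique-⁅⁆ : ∀ x → Clique ⁅ x ⁆
  clique-⁅⁆ x {i} {j} i∈ j∈ i≢j = contradiction (trans (⁅⁆⁻ {i = i} i∈) (sym (⁅⁆⁻ {i = j} j∈))) i≢j

  clique-∪ : ∀ {K L} → Clique K → Clique L → (∀ {i j} → i ∈ K → j ∈ L → i ∼ j) → Clique (K ∪ L)
  clique-∪ {K} {L} cK cL cross {i} {j} i∈ j∈ i≢j with ∪⁻ {S = K} {L} i∈ | ∪⁻ {S = K} {L} j∈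
  ... | inj₁ i∈K | inj₁ j∈K = cK i∈K j∈K i≢j
  ... | inj₁ i∈K | inj₂ j∈L = cross i∈K j∈L
  ... | inj₂ i∈L | inj₁ j∈K = ∼-sym (cross j∈K i∈L)
  ... | inj₂ i∈L | inj₂ j∈L = cL i∈L j∈L i≢j

  edge-clique : ∀ {x y} → x ∼ y → Clique (⁅ x ⁆ ∪ ⁅ y ⁆)
  edge-clique {x} {y} xy = clique-∪ (λ {i} {j} → clique-⁅⁆ x {i} {j}) (λ {i} {j} → clique-⁅⁆ y {i} {j}) cross
    where
    cross : ∀ {i j} → i ∈ ⁅ x ⁆ → j ∈ ⁅ y ⁆ → i ∼ j
    cross {i} {j} i∈ j∈ = subst₂ _∼_ (sym (⁅⁆⁻ {i = i} i∈)) (sym (⁅⁆⁻ {i = j} j∈)) xy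

  edge-weight : ∀ w {x y} → x ≢ y → w x + w y ≤ weight w (⁅ x ⁆ ∪ ⁅ y ⁆)
  edge-weight w {x} {y} x≢y = ≤-trans
    (+-mono-≤ (≤-reflexive (sym (weight-⁅⁆ w x))) (≤-reflexive (sym (weight-⁅⁆ w y))))
    (weight-disjoint {n} w {⁅ x ⁆ ∪ ⁅ y ⁆} {⁅ x ⁆} {⁅ y ⁆}
      (λ {i} → ∪⁺ˡ {S = ⁅ x ⁆} {⁅ y ⁆} {i}) (λ {i} → ∪⁺ʳ {S = ⁅ x ⁆} {⁅ y ⁆} {i})
      λ {i} i∈ i∈′ → x≢y (trans (sym (⁅⁆⁻ {i = i} i∈)) (⁅⁆⁻ {i = i} i∈′)))

  record MaxClique (S : Sub n) (w : Fin n → ℕ) : Set where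
    field
      M       : Sub n
      M-clique : Clique M
      M⊆S     : M ⊆ S
      M-max   : ∀ K → Clique K → K ⊆ S → weight w K ≤ weight w M

  clique? : ∀ K → Dec (∀ i j → i ∈ K → j ∈ K → i ≢ j → i ∼ j)
  clique? K = all? λ i → all? λ j →
    i ∈? K →-dec j ∈? K →-dec ¬? (i Fin.≟ j) →-dec adj G i j Bool.≟ true

  maxClique : ∀ S w → MaxClique S w
  maxClique S w = search (sum w) λ K _ _ → sum-mono-≤ (bound K)
    where
    bound : ∀ K i → (w ↾ K) i ≤ w i
    bound K i with K i
    ... | true  = ≤-refl
    ... | false = z≤n
    search : ∀ t → (∀ K → Clique K → K ⊆ S → weight w K ≤ t) → MaxClique S w
    search zero bounded = record
      { M = λ _ → false ; M-clique = λ () ; M⊆S = λ () ; M-max = λ K cK K⊆S → ≤-trans (bounded K cK K⊆S) z≤n }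
    search (suc t) bounded with anySubset? {P = λ v → (∀ i j → i ∈ lookup v → j ∈ lookup v → i ≢ j → i ∼ j)
                                               × (∀ i → i ∈ lookup v → i ∈ S) × suc t ≤ weight w (lookup v)}
                                (λ v → clique? (lookup v)
                                  ×-dec all? (λ i → i ∈? lookup v →-dec i ∈? S)
                                  ×-dec suc t ≤? weight w (lookup v))
    ... | yes (v , cv , v⊆S , t<v) = record
      { M = lookup v ; M-clique = λ {i} {j} → cv i j ; M⊆S = λ {i} → v⊆S i
      ; M-max = λ K cK K⊆S → ≤-trans (bounded K cK K⊆S) t<v }
    ... | no none = search t λ K cK K⊆S → ≤-pred (≰⇒> λ t<K → none (tabulate K
          , (λ i j i∈ j∈ → cK (∈-tabulate⁻ {K = K} i∈) (∈-tabulate⁻ {K = K} j∈))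
          , (λ i i∈ → K⊆S (∈-tabulate⁻ {K = K} i∈))
          , ≤-trans t<K (weight-⊆ w {K} {lookup (tabulate K)} (∈-tabulate⁺ {K = K}))))

  Multicolouring : Sub n → (Fin n → ℕ) → ℕ → Set
  Multicolouring S w k = Σ (Fin n → Sub k) λ col →
    (∀ i → i ∈ S → w i ≤ size (col i)) ×
    (∀ {i j c} → i ∈ S → j ∈ S → i ∼ j → c ∈ col i → c ∉ col j)

  -- Perfection of every clique blow-up of G[S] (Lovász), which is what survives substitution.
  WeightPerfect : Sub n → Set
  WeightPerfect S = ∀ w k → (∀ K → Clique K → K ⊆ S → weight w K ≤ k) → Multicolouring S w k

  weightPerfect-cong : ∀ {S T} → S ⊆ T → T ⊆ S → WeightPerfect S → WeightPerfect T
  weightPerfect-cong S⊆T T⊆S pS w k bound with pS w k (λ K cK K⊆S → bound K cK (λ {i} i∈ → S⊆T (K⊆S {i} i∈)))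
  ... | col , enough , proper = col , (λ i i∈ → enough i (T⊆S i∈)) , λ i∈ j∈ → proper (T⊆S i∈) (T⊆S j∈)

  BipartitionOf : Sub n → Sub n → Set
  BipartitionOf S P = ∀ i j → i ∈ S → j ∈ S → i ∼ j → P i ≢ P j

  -- One class takes the first `w i` colours and the other the last `w i`. An edge weighs at most
  -- `k`, so the two intervals at its ends are disjoint.
  bipartite⇒weightPerfect : ∀ {S} P → BipartitionOf S P → WeightPerfect S
  bipartite⇒weightPerfect {S} P bip w k bound = col , enough , proper
    where
    side : Bool → ℕ → Sub k
    side true  a = below k a
    side false a = above k (k ∸ a)
    col : Fin n → Sub k
    col i = side (P i) (w i)

    ⊆S : ∀ {i} → i ∈ S → ⁅ i ⁆ ⊆ S
    ⊆S i∈S {j} j∈ = subst (_∈ S) (sym (⁅⁆⁻ {i = j} j∈)) i∈S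

    single : ∀ {i} → i ∈ S → w i ≤ k
    single {i} i∈S = subst (_≤ k) (weight-⁅⁆ w i)
      (bound ⁅ i ⁆ (λ {x} {y} → clique-⁅⁆ i {x} {y}) (λ {j} → ⊆S i∈S {j}))

    pair : ∀ {i j} → i ∈ S → j ∈ S → i ∼ j → w i + w j ≤ k
    pair {i} {j} i∈S j∈S ij = ≤-trans (edge-weight w {i} {j} (∼⇒≢ ij)) (bound (⁅ i ⁆ ∪ ⁅ j ⁆) (edge-clique ij) sub)
      where
      sub : ⁅ i ⁆ ∪ ⁅ j ⁆ ⊆ S
      sub {x} x∈ with ∪⁻ {S = ⁅ i ⁆} {⁅ j ⁆} {x} x∈
      ... | inj₁ x∈i = ⊆S i∈S {x} x∈i
      ... | inj₂ x∈j = ⊆S j∈S {x} x∈j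

    enough : ∀ i → i ∈ S → w i ≤ size (col i)
    enough i i∈S with P i
    ... | true  = size-below k (single i∈S)
    ... | false = ≤-trans (≤-reflexive (sym (m∸[m∸n]≡n (single i∈S)))) (size-above k (k ∸ w i))

    apart : ∀ {a b c} → a + b ≤ k → c ∈ side true a → c ∉ side false b
    apart {a} {b} {c} a+b≤k c∈ c∈′ = <-irrefl refl (begin-strict
      k           ≤⟨ m≤n+m∸n k b ⟩
      b + (k ∸ b) ≤⟨ +-monoʳ-≤ b (∈-comprehension⁻ (λ c → k ∸ b ≤? toℕ c) {c} c∈′) ⟩
      b + toℕ c   <⟨ +-monoʳ-< b (∈-comprehension⁻ (λ c → toℕ c <? a) {c} c∈) ⟩
      b + a       ≡⟨ +-comm b a ⟩
      a + b       ≤⟨ a+b≤k ⟩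
      k           ∎)
      where open ≤-Reasoning

    proper : ∀ {i j c} → i ∈ S → j ∈ S → i ∼ j → c ∈ col i → c ∉ col j
    proper {i} {j} {c} i∈S j∈S ij c∈i c∈j with P i | P j | bip i j i∈S j∈S ij
    ... | true  | true  | Pi≢Pj = Pi≢Pj refl
    ... | false | false | Pi≢Pj = Pi≢Pj refl
    ... | true  | false | _ = apart {w i} {w j} {c} (pair i∈S j∈S ij) c∈i c∈j
    ... | false | true  | _ = apart {w j} {w i} {c} (pair j∈S i∈S (∼-sym ij)) c∈j c∈i

  module Substitution {X Y : Sub n} {x₀ : Fin n} (x₀∉Y : x₀ ∉ Y) (disjoint : ∀ {i} → i ∈ Y → i ∉ X)
                      (unmixed : ∀ {y x} → y ∈ Y → x ∈ X → adj G y x ≡ adj G y x₀) where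

    reweight : (Fin n → ℕ) → ℕ → Fin n → ℕ
    reweight w m i = if ⁅ x₀ ⁆ i then m else w i

    reweight-off : ∀ w m {i} → i ≢ x₀ → reweight w m i ≡ w i
    reweight-off w m {i} i≢x₀ with i Fin.≟ x₀
    ... | yes i≡x₀ = contradiction i≡x₀ i≢x₀
    ... | no _ = refl

    reweight-at : ∀ w m → reweight w m x₀ ≡ m
    reweight-at w m rewrite ⁅⁆⁺ x₀ = refl

    Y≢x₀ : ∀ {i} → i ∈ Y → i ≢ x₀
    Y≢x₀ i∈Y refl = x₀∉Y i∈Y

    record Expansion (w : Fin n → ℕ) (t : ℕ) : Set where
      constructor expansion
      field
        K     : Sub n
        clique : Clique K
        K⊆    : K ⊆ Y ∪ X
        heavy : t ≤ weight w K

    -- Exchanging `x₀` for `M` gives a clique again, as no vertex of `Y` distinguishes vertices of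
    -- `X`, and `x₀` was given exactly the weight of `M`.
    expand : ∀ w {M} → Clique M → M ⊆ X → ∀ {K} → Clique K → K ⊆ Y ∪ ⁅ x₀ ⁆ →
             Expansion w (weight (reweight w (weight w M)) K)
    expand w {M} cM M⊆X {K} cK K⊆ with x₀ ∈? K
    ... | no x₀∉K = expansion K cK (λ {i} i∈ → ∪⁺ˡ {S = Y} {X} (inY {i} i∈))
          (weight-≤ {w = reweight w _} {w} {K} {K} id
            λ {i} i∈K → ≤-reflexive (reweight-off w _ (λ { refl → x₀∉K i∈K })))
      where
      inY : K ⊆ Y
      inY {i} i∈K with ∪⁻ {S = Y} {⁅ x₀ ⁆} {i} (K⊆ i∈K)
      ... | inj₁ i∈Y = i∈Y
      ... | inj₂ i∈x₀ with refl ← ⁅⁆⁻ {i = i} i∈x₀ = contradiction i∈K x₀∉K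
    ... | yes x₀∈K = expansion ((K ∩ Y) ∪ M)
          (clique-∪ (λ i∈ j∈ → cK (proj₁ (∩⁻ {S = K} {Y} i∈)) (proj₁ (∩⁻ {S = K} {Y} j∈))) cM cross) sub
          (begin
            weight w′ K ≤⟨ weight-cover w′ {K} {K ∩ Y} {⁅ x₀ ⁆} cover ⟩
            weight w′ (K ∩ Y) + weight w′ ⁅ x₀ ⁆ ≤⟨ +-mono-≤
              (weight-≤ {w = w′} {w} {K ∩ Y} {K ∩ Y} id λ {i} i∈ →
                ≤-reflexive (reweight-off w _ (Y≢x₀ (proj₂ (∩⁻ {S = K} {Y} {i} i∈)))))
              (≤-reflexive (trans (weight-⁅⁆ w′ x₀) (reweight-at w _))) ⟩
            weight w (K ∩ Y) + weight w M ≤⟨ weight-disjoint w {(K ∩ Y) ∪ M} {K ∩ Y} {M}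
              (λ {i} → ∪⁺ˡ {S = K ∩ Y} {M} {i}) (λ {i} → ∪⁺ʳ {S = K ∩ Y} {M} {i})
              (λ {i} i∈ i∈M → disjoint (proj₂ (∩⁻ {S = K} {Y} {i} i∈)) (M⊆X i∈M)) ⟩
            weight w ((K ∩ Y) ∪ M) ∎)
      where
      open ≤-Reasoning
      w′ = reweight w (weight w M)
      cover : ∀ {i} → i ∈ K → i ∈ K ∩ Y ⊎ i ∈ ⁅ x₀ ⁆
      cover {i} i∈K with ∪⁻ {S = Y} {⁅ x₀ ⁆} {i} (K⊆ i∈K)
      ... | inj₁ i∈Y = inj₁ (∩⁺ {S = K} {Y} i∈K i∈Y)
      ... | inj₂ i∈x₀ = inj₂ i∈x₀
      cross : ∀ {i j} → i ∈ K ∩ Y → j ∈ M → i ∼ j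
      cross i∈ j∈M with ∩⁻ {S = K} {Y} i∈
      ... | i∈K , i∈Y = trans (unmixed i∈Y (M⊆X j∈M)) (cK i∈K x₀∈K (Y≢x₀ i∈Y))
      sub : (K ∩ Y) ∪ M ⊆ Y ∪ X
      sub {i} i∈ with ∪⁻ {S = K ∩ Y} {M} {i} i∈
      ... | inj₁ i∈KY = ∪⁺ˡ {S = Y} {X} (proj₂ (∩⁻ {S = K} {Y} {i} i∈KY))
      ... | inj₂ i∈M  = ∪⁺ʳ {S = Y} {X} (M⊆X i∈M)

    -- In a colouring of `Y` and `x₀`, the vertex `x₀` receives at least as many colours as the
    -- heaviest clique of `X` weighs. These suffice to colour `X`, and the neighbours of `X` in `Y`
    -- do not use them.
    weightPerfect-substitute : WeightPerfect (Y ∪ ⁅ x₀ ⁆) → WeightPerfect X → WeightPerfect (Y ∪ X)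
    weightPerfect-substitute pY pX w k bound = col , enough , proper
      where
      open MaxClique (maxClique X w)
      m  = weight w M
      w′ = reweight w m
      outer : Multicolouring (Y ∪ ⁅ x₀ ⁆) w′ k
      outer = pY w′ k λ L cL L⊆ →
        let open Expansion (expand w M-clique M⊆S {L} cL L⊆) in ≤-trans heavy (bound K clique K⊆)
      inner : Multicolouring X w m
      inner = pX w m M-max
      colY = proj₁ outer
      colX = proj₁ inner
      enoughY = proj₁ (proj₂ outer)
      properY = proj₂ (proj₂ outer)
      inY : ∀ {i} → i ∈ Y → i ∈ Y ∪ ⁅ x₀ ⁆
      inY {i} = ∪⁺ˡ {S = Y} {⁅ x₀ ⁆} {i}
      x₀∈ : x₀ ∈ Y ∪ ⁅ x₀ ⁆
      x₀∈ = ∪⁺ʳ {S = Y} {⁅ x₀ ⁆} (⁅⁆⁺ x₀)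
      m≤x₀ : m ≤ size (colY x₀)
      m≤x₀ = subst (_≤ size (colY x₀)) (reweight-at w m) (enoughY x₀ x₀∈)
      ρ : Fin k → Maybe (Fin m)
      ρ = proj₁ (rename (colY x₀) m≤x₀)
      ρ-in : ∀ c {t} → ρ c ≡ just t → c ∈ colY x₀
      ρ-in = proj₁ (proj₂ (rename (colY x₀) m≤x₀))
      ρ-size : ∀ (f : Sub m) → size f ≤ size (λ c → maybe′ f false (ρ c))
      ρ-size = proj₂ (proj₂ (rename (colY x₀) m≤x₀))

      col : Fin n → Sub k
      col i with i ∈? X
      ... | yes _ = λ c → maybe′ (colX i) false (ρ c)
      ... | no _  = colY i

      Y∪ : ∀ {i} → i ∈ Y ∪ X → i ∉ X → i ∈ Y
      Y∪ {i} i∈ i∉X with ∪⁻ {S = Y} {X} {i} i∈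
      ... | inj₁ i∈Y = i∈Y
      ... | inj₂ i∈X = contradiction i∈X i∉X

      enough : ∀ i → i ∈ Y ∪ X → w i ≤ size (col i)
      enough i i∈ with i ∈? X
      ... | yes i∈X = ≤-trans (proj₁ (proj₂ inner) i i∈X) (ρ-size (colX i))
      ... | no i∉X = subst (_≤ size (colY i)) (reweight-off w m (Y≢x₀ (Y∪ i∈ i∉X)))
                       (enoughY i (inY (Y∪ i∈ i∉X)))

      inX : ∀ {c} (f : Sub m) → maybe′ f false (ρ c) ≡ true → ∃ λ t → ρ c ≡ just t × t ∈ f
      inX {c} f c∈ with ρ c
      ... | just t = t , refl , c∈

      outside : ∀ {i j c} → i ∈ X → j ∈ Y → j ∼ i → maybe′ (colX i) false (ρ c) ≡ true → c ∉ colY j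
      outside {i} {j} {c} i∈X j∈Y ji c∈ c∈j with inX {c} (colX i) c∈
      ... | t , ρc , _ = properY (inY j∈Y) x₀∈ (trans (sym (unmixed j∈Y i∈X)) ji) c∈j (ρ-in c ρc)

      proper : ∀ {i j c} → i ∈ Y ∪ X → j ∈ Y ∪ X → i ∼ j → c ∈ col i → c ∉ col j
      proper {i} {j} {c} i∈ j∈ ij c∈i c∈j with i ∈? X | j ∈? X
      ... | no i∉X | no j∉X = properY (inY (Y∪ i∈ i∉X)) (inY (Y∪ j∈ j∉X)) ij c∈i c∈j
      ... | yes i∈X | no j∉X = outside i∈X (Y∪ j∈ j∉X) (∼-sym ij) c∈i c∈j
      ... | no i∉X | yes j∈X = outside j∈X (Y∪ i∈ i∉X) ij c∈j c∈i
      ... | yes i∈X | yes j∈X with inX {c} (colX i) c∈i | inX {c} (colX j) c∈j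
      ...   | t , ρc , t∈i | t′ , ρc′ , t′∈j with refl ← trans (sym ρc) ρc′ =
              proj₂ (proj₂ inner) i∈X j∈X ij t∈i t′∈j

-- Modules and weighted divisions

-- Links the finite search over Boolean vectors with the arbitrary predicates in `Prime` and
-- `NonBipartite`.
decideEach : ∀ {n} (P : Fin n → Set) →
             ¬ ¬ ∃ λ (v : Vec Bool n) → ∀ i → (i ∈ lookup v → P i) × (P i → i ∈ lookup v)
decideEach {zero}  P k = k ([] , λ ())
decideEach {suc n} P k = decideEach (P ∘ suc) λ (v , v-dec) → ¬¬-excluded-middle λ where
  (yes p) → k (true ∷ v , λ { zero → (λ _ → p) , (λ _ → refl) ; (suc i) → v-dec i })
  (no ¬p) → k (false ∷ v , λ { zero → (λ ()) , (λ p → contradiction p ¬p) ; (suc i) → v-dec i })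

≡true-ext : ∀ {a b} → (a ≡ true → b ≡ true) → (b ≡ true → a ≡ true) → a ≡ b
≡true-ext {true}  {b}     f g = sym (f refl)
≡true-ext {false} {true}  f g = g refl
≡true-ext {false} {false} f g = refl

module _ {n} (G : Graph n) where

  subgraph-≡ : ∀ {S : Sub n} {x y : ∃ (_∈ S)} → proj₁ x ≡ proj₁ y → x ≡ y
  subgraph-≡ {x = i , i∈} {.i , i∈′} refl = cong (i ,_) (uip i∈ i∈′)

  subgraph : Sub n → Gr
  subgraph S = record
    { V     = ∃ (_∈ S)
    ; _~_   = λ x y → adj G (proj₁ x) (proj₁ y) ≡ true
    ; _~?_  = λ x y → adj G (proj₁ x) (proj₁ y) Bool.≟ true
    ; ~-sym = ∼-sym G
    ; ~-irr = ∼-irr G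
    ; _≟_   = λ x y → equal? x y
    }
    where
    equal? : (x y : ∃ (_∈ S)) → Dec (x ≡ y)
    equal? x y with proj₁ x Fin.≟ proj₁ y
    ... | yes eq = yes (subgraph-≡ eq)
    ... | no neq = no (neq ∘ cong proj₁)

  inclusion : ∀ {S T} → T ⊆ S → subgraph T ↪ subgraph S
  inclusion T⊆S = record { to = λ (i , i∈) → i , T⊆S i∈ ; ~⁺ = id ; ~⁻ = id }

  IsModule : Sub n → Sub n → Set
  IsModule S X = (∀ i → i ∈ X → i ∈ S) × (∃ λ a → ∃ λ b → a ∈ X × b ∈ X × a ≢ b) × (∃ λ c → c ∈ S × c ∉ X) ×
                 (∀ z x y → z ∈ S → z ∉ X → x ∈ X → y ∈ X → adj G z x ≡ adj G z y)

  isModule? : ∀ S X → Dec (IsModule S X)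
  isModule? S X =
    all? (λ i → i ∈? X →-dec i ∈? S) ×-dec
    any? (λ a → any? λ b → a ∈? X ×-dec b ∈? X ×-dec ¬? (a Fin.≟ b)) ×-dec
    any? (λ c → c ∈? S ×-dec ¬? (c ∈? X)) ×-dec
    all? (λ z → all? λ x → all? λ y →
      z ∈? S →-dec ¬? (z ∈? X) →-dec x ∈? X →-dec y ∈? X →-dec adj G z x Bool.≟ adj G z y)

  module _ {S : Sub n} where
    open Gr (subgraph S)

    noModule⇒prime : (∀ v → ¬ IsModule S (lookup v)) → Prime
    noModule⇒prime none P {a} {b} {c} a≢b pa pb ¬pc unmixed =
      decideEach (λ i → ∃ λ i∈ → P (i , i∈)) λ (v , v-dec) → none v
        ( (λ i i∈v → proj₁ (proj₁ (v-dec i) i∈v))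
        , (proj₁ a , proj₁ b , proj₂ (v-dec _) (proj₂ a , pa) , proj₂ (v-dec _) (proj₂ b , pb) , a≢b ∘ subgraph-≡ {S} {a} {b})
        , (proj₁ c , proj₂ c , λ c∈v → ¬pc (at c (proj₁ (v-dec _) c∈v)))
        , λ z x y z∈S z∉v x∈v y∈v → let
            ¬pz = λ pz → z∉v (proj₂ (v-dec z) (z∈S , pz))
            x∈S , px = proj₁ (v-dec x) x∈v
            y∈S , py = proj₁ (v-dec y) y∈v
          in ≡true-ext
            (λ zx → ~-stable {z , z∈S} {y , y∈S} λ ¬zy → unmixed ¬pz px py zx ¬zy)
            (λ zy → ~-stable {z , z∈S} {x , x∈S} λ ¬zx → unmixed ¬pz py px zy ¬zx))
      where
      at : ∀ (c : V) → (∃ λ i∈ → P (proj₁ c , i∈)) → P c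
      at (i , i∈) (i∈′ , p) = subst (λ e → P (i , e)) (uip i∈′ i∈) p

    noBipartition⇒nonBipartite : (∀ v → ¬ BipartitionOf G S (lookup v)) → NonBipartite
    noBipartition⇒nonBipartite none P in-P out-P =
      decideEach (λ i → ∃ λ i∈ → P (i , i∈)) λ (v , v-dec) → none v λ i j i∈S j∈S ij eq →
        ¬¬-excluded-middle λ where
          (yes pi) → in-P ij pi (at j∈S (proj₁ (v-dec j) (trans (sym eq) (proj₂ (v-dec i) (i∈S , pi)))))
          (no ¬pi) → out-P ij ¬pi λ pj →
            ¬pi (at i∈S (proj₁ (v-dec i) (trans eq (proj₂ (v-dec j) (j∈S , pj)))))
      where
      at : ∀ {i} (i∈ : i ∈ S) → (∃ λ i∈ → P (i , i∈)) → P (i , i∈)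
      at {i} i∈ (i∈′ , p) = subst (λ e → P (i , e)) (uip i∈′ i∈) p

  -- The module is represented by one of its own vertices, so the contracted graph is again an
  -- induced subgraph.
  record Contraction (S X : Sub n) (x₀ : Fin n) : Set where
    field
      x₀∈X     : x₀ ∈ X
      X⊆S      : X ⊆ S
      x₀∉rest  : x₀ ∉ S ∖ X
      disjoint : ∀ {i} → i ∈ S ∖ X → i ∉ X
      unmixed  : ∀ {y x} → y ∈ S ∖ X → x ∈ X → adj G y x ≡ adj G y x₀
      size-X   : size X < size S
      size-S/X : size ((S ∖ X) ∪ ⁅ x₀ ⁆) < size S
      S/X⊆S    : (S ∖ X) ∪ ⁅ x₀ ⁆ ⊆ S
      cover    : S ⊆ (S ∖ X) ∪ X
      cover⁻   : (S ∖ X) ∪ X ⊆ S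

  contract : ∀ {S X} → IsModule S X → ∃ (Contraction S X)
  contract {S} {X} (X⊆S , (a , b , a∈X , b∈X , a≢b) , (c , c∈S , c∉X) , unmixed) = a , record
    { x₀∈X = a∈X
    ; X⊆S = λ {i} → X⊆S i
    ; x₀∉rest = λ a∈ → proj₂ (∖⁻ {S = S} {X} a∈) a∈X
    ; disjoint = λ {i} i∈ → proj₂ (∖⁻ {S = S} {X} {i} i∈)
    ; unmixed = λ {y} {x} y∈ x∈ → let y∈S , y∉X = ∖⁻ {S = S} {X} y∈ in unmixed y x a y∈S y∉X x∈ a∈X
    ; size-X = weight-⊂ (λ _ → 1) {X} {S} (λ {i} → X⊆S i) {c} c∈S c∉X (s≤s z≤n)
    ; size-S/X = weight-⊂ (λ _ → 1) {(S ∖ X) ∪ ⁅ a ⁆} {S} S/X⊆S {b} (X⊆S b b∈X) b∉ (s≤s z≤n)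
    ; S/X⊆S = S/X⊆S
    ; cover = cover
    ; cover⁻ = cover⁻
    }
    where
    S/X⊆S : (S ∖ X) ∪ ⁅ a ⁆ ⊆ S
    S/X⊆S {i} i∈ with ∪⁻ {S = S ∖ X} {⁅ a ⁆} {i} i∈
    ... | inj₁ i∈S∖X = proj₁ (∖⁻ {S = S} {X} {i} i∈S∖X)
    ... | inj₂ i∈a   = subst (_∈ S) (sym (⁅⁆⁻ {i = i} i∈a)) (X⊆S a a∈X)
    b∉ : b ∉ (S ∖ X) ∪ ⁅ a ⁆
    b∉ b∈ with ∪⁻ {S = S ∖ X} {⁅ a ⁆} b∈
    ... | inj₁ b∈S∖X = proj₂ (∖⁻ {S = S} {X} b∈S∖X) b∈X
    ... | inj₂ b∈a   = a≢b (sym (⁅⁆⁻ b∈a))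
    cover : S ⊆ (S ∖ X) ∪ X
    cover {i} i∈S with i ∈? X
    ... | yes i∈X = ∪⁺ʳ {S = S ∖ X} {X} i∈X
    ... | no i∉X  = ∪⁺ˡ {S = S ∖ X} {X} (∖⁺ {S = S} {X} i∈S i∉X)
    cover⁻ : (S ∖ X) ∪ X ⊆ S
    cover⁻ {i} i∈ with ∪⁻ {S = S ∖ X} {X} {i} i∈
    ... | inj₁ i∈S∖X = proj₁ (∖⁻ {S = S} {X} {i} i∈S∖X)
    ... | inj₂ i∈X   = X⊆S i i∈X

  module? : ∀ S → Dec (∃ λ (v : Vec Bool n) → IsModule S (lookup v))
  module? S = anySubset? (isModule? S ∘ lookup)

  NoPrimeNonBipartite : Sub n → Set₁
  NoPrimeNonBipartite T = ∀ F → F ⊆ T → Gr.Prime (subgraph F) → Gr.NonBipartite (subgraph F) → ⊥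

  -- A module exhibits `T` as a substitution of two smaller induced subgraphs; without a module, `T`
  -- is prime and therefore bipartite.
  noPrimeNonBipartite⇒weightPerfect : ∀ T → NoPrimeNonBipartite T → WeightPerfect G T
  noPrimeNonBipartite⇒weightPerfect T = go (suc (size T)) T ≤-refl
    where
    go : ∀ k T → size T < k → NoPrimeNonBipartite T → WeightPerfect G T
    go (suc k) T (s≤s T≤k) none with module? T
    ... | yes (v , mod) with contract mod
    ...   | x₀ , con = weightPerfect-cong G cover⁻ cover (weightPerfect-substitute
              (go k ((T ∖ X) ∪ ⁅ x₀ ⁆) (≤-trans size-S/X T≤k) λ F F⊆ → none F (λ {i} i∈ → S/X⊆S {i} (F⊆ i∈)))
              (go k X (≤-trans size-X T≤k) λ F F⊆ → none F (λ {i} i∈ → X⊆S {i} (F⊆ i∈))))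
      where
      X = lookup v
      open Contraction con
      open Substitution G {X} {T ∖ X} {x₀} x₀∉rest (λ {i} → disjoint {i}) unmixed
    go (suc k) T (s≤s T≤k) none | no ¬mod with anySubset? {P = BipartitionOf G T ∘ lookup} (bipartition? ∘ lookup)
      where
      bipartition? : ∀ P → Dec (BipartitionOf G T P)
      bipartition? P = all? λ i → all? λ j →
        i ∈? T →-dec j ∈? T →-dec adj G i j Bool.≟ true →-dec ¬? (P i Bool.≟ P j)
    ... | yes (v , bip) = bipartite⇒weightPerfect G {T} (lookup v) bip
    ... | no ¬bip = ⊥-elim (none T id (noModule⇒prime (λ v m → ¬mod (v , m)))
                                      (noBipartition⇒nonBipartite (λ v b → ¬bip (v , b))))

  record Dominated (w : Fin n → ℕ) (S K : Sub n) : Set where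
    constructor dominated
    field
      L       : Sub n
      L-clique : Clique G L
      L⊆S     : L ⊆ S
      K<L     : weight w K < weight w L

  -- Domination replaces the comparison of two maxima: each clique avoiding `A` is outweighed within
  -- `S`. This includes the empty clique, so `S` must be nonempty.
  record WeightDivision (S : Sub n) (w : Fin n → ℕ) : Set where
    field
      A         : Sub n
      A⊆S       : A ⊆ S
      A-perfect : WeightPerfect G A
      dominate  : ∀ K → Clique G K → K ⊆ S → (∀ {i} → i ∈ K → i ∉ A) → Dominated w S K

  divideByAnticentre : ∀ {S v} w → (∀ i → 0 < w i) → v ∈ S →
    WeightPerfect G (comprehension (λ i → i ∈? S ×-dec ¬? (adj G i v Bool.≟ true))) → WeightDivision S w
  divideByAnticentre {S} {v} w w>0 v∈S perfect = record
    { A = A ; A⊆S = λ {i} i∈ → proj₁ (A⁻ {i} i∈) ; A-perfect = perfect ; dominate = dom }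
    where
    P? = λ i → i ∈? S ×-dec ¬? (adj G i v Bool.≟ true)
    A = comprehension P?
    A⁻ : ∀ {i} → i ∈ A → i ∈ S × ¬ adj G i v ≡ true
    A⁻ {i} = ∈-comprehension⁻ P? {i}
    dom : ∀ K → Clique G K → K ⊆ S → (∀ {i} → i ∈ K → i ∉ A) → Dominated w S K
    dom K cK K⊆S avoid = dominated (K ∪ ⁅ v ⁆)
      (clique-∪ G cK (λ {i} {j} → clique-⁅⁆ G v {i} {j}) λ {i} {j} i∈ j∈ →
        subst (λ j → adj G i j ≡ true) (sym (⁅⁆⁻ {i = j} j∈)) (~v i∈))
      sub
      (weight-⊂ w {K} {K ∪ ⁅ v ⁆} (λ {i} → ∪⁺ˡ {S = K} {⁅ v ⁆} {i}) {v} (∪⁺ʳ {S = K} {⁅ v ⁆} (⁅⁆⁺ v))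
        (λ v∈K → ∼-irr G (~v v∈K)) (w>0 v))
      where
      ~v : ∀ {i} → i ∈ K → adj G i v ≡ true
      ~v {i} i∈K = decidable-stable (adj G i v Bool.≟ true) λ ¬iv →
        avoid i∈K (∈-comprehension⁺ P? {i} (K⊆S i∈K , ¬iv))
      sub : K ∪ ⁅ v ⁆ ⊆ S
      sub {i} i∈ with ∪⁻ {S = K} {⁅ v ⁆} {i} i∈
      ... | inj₁ i∈K = K⊆S i∈K
      ... | inj₂ i∈v = subst (_∈ S) (sym (⁅⁆⁻ {i = i} i∈v)) v∈S

  ProperOn : Sub n → (Fin n → Fin 3) → Set
  ProperOn S c = ∀ {i j} → i ∈ S → j ∈ S → adj G i j ≡ true → c i ≢ c j

  -- The perfect part has colours 0 and 1, together with the isolated vertices of colour 2, which no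
  -- neighbour could outweigh. A clique avoiding it is empty or one vertex with a neighbour to add.
  divideByColouring : ∀ {S s} w → (∀ i → 0 < w i) → s ∈ S → ∀ c → ProperOn S c → WeightDivision S w
  divideByColouring {S} {s} w w>0 s∈S c proper = record
    { A = A ; A⊆S = λ {i} i∈ → proj₁ (A⁻ {i} i∈)
    ; A-perfect = bipartite⇒weightPerfect G {A} (λ i → does (c i Fin.≟ zero)) bip ; dominate = dom }
    where
    two : Fin 3
    two = suc (suc zero)
    neighbour? : ∀ i → Dec (∃ λ j → j ∈ S × adj G i j ≡ true)
    neighbour? i = any? λ j → j ∈? S ×-dec adj G i j Bool.≟ true
    P? = λ i → i ∈? S ×-dec (¬? (c i Fin.≟ two) ⊎-dec ¬? (neighbour? i))
    A = comprehension P?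
    A⁻ : ∀ {i} → i ∈ A → i ∈ S × (c i ≢ two ⊎ ¬ ∃ λ j → j ∈ S × adj G i j ≡ true)
    A⁻ {i} = ∈-comprehension⁻ P? {i}

    bip : BipartitionOf G A (λ i → does (c i Fin.≟ zero))
    bip i j i∈A j∈A ij with A⁻ {i} i∈A | A⁻ {j} j∈A
    ... | i∈S , inj₂ isolated | _ = contradiction (j , proj₁ (A⁻ {j} j∈A) , ij) isolated
    ... | i∈S , inj₁ _ | j∈S , inj₂ isolated = contradiction (i , i∈S , ∼-sym G ij) isolated
    ... | i∈S , inj₁ ci≢2 | j∈S , inj₁ cj≢2 with c i | c j | proper i∈S j∈S ij
    ...   | zero        | zero        | ci≢cj = contradiction refl ci≢cj
    ...   | zero        | suc _       | _     = λ ()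
    ...   | suc _       | zero        | _     = λ ()
    ...   | suc zero    | suc zero    | ci≢cj = contradiction refl ci≢cj
    ...   | suc (suc zero) | _        | _     = contradiction refl ci≢2
    ...   | suc zero | suc (suc zero) | _     = contradiction refl cj≢2

    dom : ∀ K → Clique G K → K ⊆ S → (∀ {i} → i ∈ K → i ∉ A) → Dominated w S K
    dom K cK K⊆S avoid with any? (_∈? K)
    ... | no empty = dominated ⁅ s ⁆ (λ {i} {j} → clique-⁅⁆ G s {i} {j})
            (λ {i} i∈ → subst (_∈ S) (sym (⁅⁆⁻ {i = i} i∈)) s∈S)
            (weight-⊂ w {K} {⁅ s ⁆} (λ {i} i∈ → contradiction (i , i∈) empty) {s} (⁅⁆⁺ s) (λ s∈ → empty (s , s∈)) (w>0 s))
    ... | yes (i , i∈K) with neighbour? i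
    ...   | no isolated = contradiction (∈-comprehension⁺ P? {i} (K⊆S i∈K , inj₂ isolated)) (avoid i∈K)
    ...   | yes (j , j∈S , ij) = dominated (⁅ i ⁆ ∪ ⁅ j ⁆) (edge-clique G ij) sub
            (weight-⊂ w {K} {⁅ i ⁆ ∪ ⁅ j ⁆} (λ {x} x∈ → ∪⁺ˡ {S = ⁅ i ⁆} {⁅ j ⁆} {x} (only x∈))
              {j} (∪⁺ʳ {S = ⁅ i ⁆} {⁅ j ⁆} {j} (⁅⁆⁺ j)) (λ j∈K → ∼⇒≢ G ij (sym (⁅⁆⁻ {i = j} (only j∈K)))) (w>0 j))
      where
      colour : ∀ {x} → x ∈ K → c x ≡ two
      colour {x} x∈K = decidable-stable (c x Fin.≟ two) λ ≢two →
        avoid x∈K (∈-comprehension⁺ P? {x} (K⊆S x∈K , inj₁ ≢two))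
      only : ∀ {x} → x ∈ K → x ∈ ⁅ i ⁆
      only {x} x∈K = dec-true (x Fin.≟ i) (decidable-stable (x Fin.≟ i) λ x≢i →
        proper (K⊆S x∈K) (K⊆S i∈K) (cK x∈K i∈K x≢i) (trans (colour x∈K) (sym (colour i∈K))))
      sub : ⁅ i ⁆ ∪ ⁅ j ⁆ ⊆ S
      sub {x} x∈ with ∪⁻ {S = ⁅ i ⁆} {⁅ j ⁆} {x} x∈
      ... | inj₁ x∈i = subst (_∈ S) (sym (⁅⁆⁻ {i = x} x∈i)) (K⊆S i∈K)
      ... | inj₂ x∈j = subst (_∈ S) (sym (⁅⁆⁻ {i = x} x∈j)) j∈S

  module ModuleStep {S X : Sub n} {x₀ : Fin n} (con : Contraction S X x₀)
    {w : Fin n → ℕ} (w>0 : ∀ i → 0 < w i) where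
    open Contraction con
    Y : Sub n
    Y = S ∖ X
    open MaxClique (maxClique G X w)
    private module Sb = Substitution G {X} {Y} {x₀} x₀∉rest (λ {i} → disjoint {i}) unmixed

    w′ : Fin n → ℕ
    w′ = Sb.reweight w (weight w M)

    Y≢x₀ : ∀ {i} → i ∈ Y → i ≢ x₀
    Y≢x₀ = Sb.Y≢x₀

    inY : ∀ {i} → i ∈ Y → i ∈ Y ∪ ⁅ x₀ ⁆
    inY {i} = ∪⁺ˡ {S = Y} {⁅ x₀ ⁆} {i}

    w′-off : ∀ {i} → i ∈ Y → w i ≤ w′ i
    w′-off i∈Y = ≤-reflexive (sym (Sb.reweight-off w _ (Y≢x₀ i∈Y)))

    M>0 : 0 < weight w M
    M>0 = ≤-trans (w>0 x₀) (≤-trans (≤-reflexive (sym (weight-⁅⁆ w x₀)))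
      (M-max ⁅ x₀ ⁆ (λ {i} {j} → clique-⁅⁆ G x₀ {i} {j}) (λ {i} i∈ → subst (_∈ X) (sym (⁅⁆⁻ {i = i} i∈)) x₀∈X)))

    w′>0 : ∀ i → 0 < w′ i
    w′>0 i with ⁅ x₀ ⁆ i
    ... | true  = M>0
    ... | false = w>0 i

    expandDominated : ∀ {K t} → t ≤ weight w′ K → Dominated w′ (Y ∪ ⁅ x₀ ⁆) K →
                      ∀ {K₀} → weight w K₀ ≤ t → Dominated w S K₀
    expandDominated t≤K (dominated L cL L⊆ K<L) K₀≤t with Sb.expand w M-clique M⊆S {L} cL L⊆
    ... | Sb.expansion L′ cL′ L′⊆ heavy =
      dominated L′ cL′ (λ {i} i∈ → cover⁻ {i} (L′⊆ i∈)) (≤-trans (s≤s (≤-trans K₀≤t t≤K)) (≤-trans K<L heavy))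

    side : ∀ {K i} → K ⊆ S → i ∈ K → i ∈ K ∩ Y ⊎ i ∈ K ∩ X
    side {K} {i} K⊆S i∈K with i ∈? X
    ... | yes i∈X = inj₂ (∩⁺ {S = K} {X} i∈K i∈X)
    ... | no i∉X  = inj₁ (∩⁺ {S = K} {Y} i∈K (∖⁺ {S = S} {X} (K⊆S i∈K) i∉X))

    module _ (DY : WeightDivision (Y ∪ ⁅ x₀ ⁆) w′) where
      private module DY = WeightDivision DY

      away : ∀ K → Clique G K → K ⊆ S → (∀ {i} → i ∈ K → i ∉ X) → (∀ {i} → i ∈ K → i ∉ DY.A) → Dominated w S K
      away K cK K⊆S noX avoid = expandDominated ≤-refl
        (DY.dominate K cK (λ {i} i∈ → inY (K⊆Y i∈)) avoid)
        (weight-≤ {w = w} {w′} {K} {K} id (λ {i} i∈ → w′-off (K⊆Y {i} i∈)))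
        where
        K⊆Y : K ⊆ Y
        K⊆Y {i} i∈K = ∖⁺ {S = S} {X} (K⊆S i∈K) (noX i∈K)

      cross : ∀ {K j} → Clique G K → j ∈ K → j ∈ X → ∀ {i x} → i ∈ K ∩ Y → x ∈ X → adj G i x ≡ true
      cross {K} {j} cK j∈K j∈X {i} i∈ x∈X with ∩⁻ {S = K} {Y} i∈
      ... | i∈K , i∈Y = trans (trans (unmixed i∈Y x∈X) (sym (unmixed i∈Y j∈X)))
                              (cK i∈K j∈K λ { refl → disjoint {i} i∈Y j∈X })

      -- The perfect part of `X` is substituted for `x₀`. A clique meeting `X` is improved within
      -- `X`, any other one in the contracted graph.
      expandInside : x₀ ∈ DY.A → WeightDivision X w → WeightDivision S w
      expandInside x₀∈A DX = record { A = A ; A⊆S = A⊆S ; A-perfect = perfect ; dominate = dom }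
        where
        module DX = WeightDivision DX
        A₁ = DY.A ∩ Y
        A = A₁ ∪ DX.A
        A₁⊆Y : A₁ ⊆ Y
        A₁⊆Y {i} i∈ = proj₂ (∩⁻ {S = DY.A} {Y} {i} i∈)

        A⊆S : A ⊆ S
        A⊆S {i} i∈ with ∪⁻ {S = A₁} {DX.A} {i} i∈
        ... | inj₁ i∈A₁ = proj₁ (∖⁻ {S = S} {X} {i} (A₁⊆Y {i} i∈A₁))
        ... | inj₂ i∈DX = X⊆S (DX.A⊆S i∈DX)

        outer⊆ : DY.A ⊆ A₁ ∪ ⁅ x₀ ⁆
        outer⊆ {i} i∈A with ∪⁻ {S = Y} {⁅ x₀ ⁆} {i} (DY.A⊆S i∈A)
        ... | inj₁ i∈Y  = ∪⁺ˡ {S = A₁} {⁅ x₀ ⁆} (∩⁺ {S = DY.A} {Y} i∈A i∈Y)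
        ... | inj₂ i∈x₀ = ∪⁺ʳ {S = A₁} {⁅ x₀ ⁆} i∈x₀
        outer⊇ : A₁ ∪ ⁅ x₀ ⁆ ⊆ DY.A
        outer⊇ {i} i∈ with ∪⁻ {S = A₁} {⁅ x₀ ⁆} {i} i∈
        ... | inj₁ i∈A₁ = proj₁ (∩⁻ {S = DY.A} {Y} {i} i∈A₁)
        ... | inj₂ i∈x₀ = subst (_∈ DY.A) (sym (⁅⁆⁻ {i = i} i∈x₀)) x₀∈A

        module S′ = Substitution G {DX.A} {A₁} {x₀} (λ x₀∈ → x₀∉rest (A₁⊆Y {x₀} x₀∈))
                      (λ {i} i∈ i∈X → disjoint {i} (A₁⊆Y {i} i∈) (DX.A⊆S i∈X))
                      (λ {y} y∈ x∈ → unmixed (A₁⊆Y {y} y∈) (DX.A⊆S x∈))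

        perfect : WeightPerfect G A
        perfect = S′.weightPerfect-substitute (weightPerfect-cong G outer⊆ outer⊇ DY.A-perfect) DX.A-perfect

        dom : ∀ K → Clique G K → K ⊆ S → (∀ {i} → i ∈ K → i ∉ A) → Dominated w S K
        dom K cK K⊆S avoid with any? (λ i → i ∈? K ×-dec i ∈? X)
        ... | no none = away K cK K⊆S (λ {i} i∈K i∈X → none (i , i∈K , i∈X)) λ {i} i∈K i∈A →
                avoid i∈K (∪⁺ˡ {S = A₁} {DX.A} (∩⁺ {S = DY.A} {Y} i∈A
                  (∖⁺ {S = S} {X} (K⊆S i∈K) λ i∈X → none (i , i∈K , i∈X))))
        ... | yes (j , j∈K , j∈X) = expandBy (DX.dominate (K ∩ X)
                (clique-⊆ G {K ∩ X} {K} (λ {i} i∈ → proj₁ (∩⁻ {S = K} {X} {i} i∈)) cK)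
                (λ {i} i∈ → proj₂ (∩⁻ {S = K} {X} {i} i∈))
                λ {i} i∈ i∈A → avoid (proj₁ (∩⁻ {S = K} {X} {i} i∈)) (∪⁺ʳ {S = A₁} {DX.A} i∈A))
          where
          expandBy : Dominated w X (K ∩ X) → Dominated w S K
          expandBy (dominated L cL L⊆X K<L) = dominated ((K ∩ Y) ∪ L)
            (clique-∪ G (clique-⊆ G {K ∩ Y} {K} (λ {i} i∈ → proj₁ (∩⁻ {S = K} {Y} {i} i∈)) cK) cL
              λ {i} i∈ x∈ → cross {K} cK j∈K j∈X {i} i∈ (L⊆X x∈))
            sub
            (begin-strict
              weight w K                          ≤⟨ weight-cover w {K} {K ∩ Y} {K ∩ X} (side {K} K⊆S) ⟩
              weight w (K ∩ Y) + weight w (K ∩ X) <⟨ +-monoʳ-< (weight w (K ∩ Y)) K<L ⟩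
              weight w (K ∩ Y) + weight w L       ≤⟨ weight-disjoint w {(K ∩ Y) ∪ L} {K ∩ Y} {L}
                (λ {i} → ∪⁺ˡ {S = K ∩ Y} {L} {i}) (λ {i} → ∪⁺ʳ {S = K ∩ Y} {L} {i})
                (λ {i} i∈ i∈L → disjoint {i} (proj₂ (∩⁻ {S = K} {Y} {i} i∈)) (L⊆X i∈L)) ⟩
              weight w ((K ∩ Y) ∪ L)              ∎)
            where
            open ≤-Reasoning
            sub : (K ∩ Y) ∪ L ⊆ S
            sub {i} i∈ with ∪⁻ {S = K ∩ Y} {L} {i} i∈
            ... | inj₁ i∈K = K⊆S (proj₁ (∩⁻ {S = K} {Y} {i} i∈K))
            ... | inj₂ i∈L = X⊆S (L⊆X i∈L)

      -- A clique meeting `X` becomes a clique through `x₀` that is at least as heavy and still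
      -- avoids the perfect part.
      expandOutside : x₀ ∉ DY.A → WeightDivision S w
      expandOutside x₀∉A = record
        { A = DY.A ; A⊆S = λ {i} i∈ → S/X⊆S {i} (DY.A⊆S i∈) ; A-perfect = DY.A-perfect ; dominate = dom }
        where
        dom : ∀ K → Clique G K → K ⊆ S → (∀ {i} → i ∈ K → i ∉ DY.A) → Dominated w S K
        dom K cK K⊆S avoid with any? (λ i → i ∈? K ×-dec i ∈? X)
        ... | no none = away K cK K⊆S (λ {i} i∈K i∈X → none (i , i∈K , i∈X)) avoid
        ... | yes (j , j∈K , j∈X) = expandDominated ≤-refl
                (DY.dominate K′
                  (clique-∪ G (clique-⊆ G {K ∩ Y} {K} (λ {i} i∈ → proj₁ (∩⁻ {S = K} {Y} {i} i∈)) cK)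
                    (λ {i} {j} → clique-⁅⁆ G x₀ {i} {j})
                    λ {i} {x} i∈ x∈ → cross {K} cK j∈K j∈X {i} i∈ (subst (_∈ X) (sym (⁅⁆⁻ {i = x} x∈)) x₀∈X))
                  sub avoid′)
                {K} (begin
                  weight w K                          ≤⟨ weight-cover w {K} {K ∩ Y} {K ∩ X} (side {K} K⊆S) ⟩
                  weight w (K ∩ Y) + weight w (K ∩ X) ≤⟨ +-mono-≤
                    (weight-≤ {w = w} {w′} {K ∩ Y} {K ∩ Y} id λ {i} i∈ → w′-off (proj₂ (∩⁻ {S = K} {Y} {i} i∈)))
                    (≤-trans (M-max (K ∩ X) (clique-⊆ G {K ∩ X} {K} (λ {i} i∈ → proj₁ (∩⁻ {S = K} {X} {i} i∈)) cK)
                                (λ {i} i∈ → proj₂ (∩⁻ {S = K} {X} {i} i∈)))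
                      (≤-reflexive (sym (trans (weight-⁅⁆ w′ x₀) (Sb.reweight-at w _))))) ⟩
                  weight w′ (K ∩ Y) + weight w′ ⁅ x₀ ⁆ ≤⟨ weight-disjoint w′ {K′} {K ∩ Y} {⁅ x₀ ⁆}
                    (λ {i} → ∪⁺ˡ {S = K ∩ Y} {⁅ x₀ ⁆} {i}) (λ {i} → ∪⁺ʳ {S = K ∩ Y} {⁅ x₀ ⁆} {i})
                    (λ {i} i∈ i∈x₀ → Y≢x₀ (proj₂ (∩⁻ {S = K} {Y} {i} i∈)) (⁅⁆⁻ {i = i} i∈x₀)) ⟩
                  weight w′ K′                        ∎)
          where
          open ≤-Reasoning
          K′ = (K ∩ Y) ∪ ⁅ x₀ ⁆
          sub : K′ ⊆ Y ∪ ⁅ x₀ ⁆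
          sub {i} i∈ with ∪⁻ {S = K ∩ Y} {⁅ x₀ ⁆} {i} i∈
          ... | inj₁ i∈K  = inY (proj₂ (∩⁻ {S = K} {Y} {i} i∈K))
          ... | inj₂ i∈x₀ = ∪⁺ʳ {S = Y} {⁅ x₀ ⁆} i∈x₀
          avoid′ : ∀ {i} → i ∈ K′ → i ∉ DY.A
          avoid′ {i} i∈ i∈A with ∪⁻ {S = K ∩ Y} {⁅ x₀ ⁆} {i} i∈
          ... | inj₁ i∈K  = avoid (proj₁ (∩⁻ {S = K} {Y} {i} i∈K)) i∈A
          ... | inj₂ i∈x₀ = x₀∉A (subst (_∈ DY.A) (⁅⁆⁻ {i = i} i∈x₀) i∈A)

  weightDivision : (∀ S {s} → s ∈ S → Gr.Prime (subgraph S) → ∀ w → (∀ i → 0 < w i) → WeightDivision S w) →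
                   ∀ S {s} → s ∈ S → ∀ w → (∀ i → 0 < w i) → WeightDivision S w
  weightDivision prime-case S = go (suc (size S)) S ≤-refl
    where
    go : ∀ k S → size S < k → ∀ {s} → s ∈ S → ∀ w → (∀ i → 0 < w i) → WeightDivision S w
    go (suc k) S (s≤s S≤k) s∈S w w>0 with module? S
    ... | no ¬mod = prime-case S s∈S (noModule⇒prime (λ v m → ¬mod (v , m))) w w>0
    ... | yes (v , mod) with contract mod
    ...   | x₀ , con = choose (x₀ ∈? WeightDivision.A DY)
      where
      X = lookup v
      open Contraction con
      open ModuleStep con w>0
      DY : WeightDivision (Y ∪ ⁅ x₀ ⁆) w′
      DY = go k (Y ∪ ⁅ x₀ ⁆) (≤-trans size-S/X S≤k) {x₀} (∪⁺ʳ {S = Y} {⁅ x₀ ⁆} (⁅⁆⁺ x₀)) w′ w′>0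
      choose : Dec (x₀ ∈ WeightDivision.A DY) → WeightDivision S w
      choose (yes x₀∈) = expandInside DY x₀∈ (go k X (≤-trans size-X S≤k) x₀∈X w w>0)
      choose (no x₀∉)  = expandOutside DY x₀∉

-- From subsets to the graphs of the statement

select-∈ : ∀ {n} (s : Vec Bool n) i → select s i ∈ lookup s
select-∈ (true ∷ s)  zero    = refl
select-∈ (true ∷ s)  (suc i) = select-∈ s i
select-∈ (false ∷ s) i       = select-∈ s i

select-injective : ∀ {n} (s : Vec Bool n) → Injective _≡_ _≡_ (select s)
select-injective (true ∷ s)  {zero}  {zero}  _  = refl
select-injective (true ∷ s)  {suc i} {suc j} eq = cong suc (select-injective s (Fin.suc-injective eq))
select-injective (false ∷ s) eq = select-injective s (Fin.suc-injective eq)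

select-surjective : ∀ {n} (s : Vec Bool n) {i} → i ∈ lookup s → ∃ λ j → select s j ≡ i
select-surjective (true ∷ s) {zero}  _ = zero , refl
select-surjective (true ∷ s) {suc i} i∈ with select-surjective s i∈
... | j , eq = suc j , cong suc eq
select-surjective (false ∷ s) {suc i} i∈ with select-surjective s i∈
... | j , eq = j , cong suc eq

count≡size : ∀ {n} (s : Vec Bool n) → count s ≡ size (lookup s)
count≡size []          = refl
count≡size (true ∷ s)  = cong suc (count≡size s)
count≡size (false ∷ s) = count≡size s

module _ {n} (K : Sub n) where
  count-tabulate : count (tabulate K) ≡ size K
  count-tabulate = trans (count≡size (tabulate K)) (≤-antisym
    (size-⊆ (lookup (tabulate K)) K (∈-tabulate⁻ {K = K})) (size-⊆ K (lookup (tabulate K)) (∈-tabulate⁺ {K = K})))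

  chooseFrom : ∀ {t} → t ≤ size K → ∃ λ (f : Fin t → Fin n) → Injective _≡_ _≡_ f × (∀ a → f a ∈ K)
  chooseFrom {t} t≤K = (λ a → select (tabulate K) (inject≤ a t≤count))
    , (λ eq → Fin.inject≤-injective t≤count t≤count _ _ (select-injective (tabulate K) eq))
    , (λ a → ∈-tabulate⁻ {K = K} (select-∈ (tabulate K) _))
    where
    t≤count : t ≤ count (tabulate K)
    t≤count = subst (t ≤_) (sym count-tabulate) t≤K

  inhabitant : 1 ≤ size K → ∃ (_∈ K)
  inhabitant 1≤K = let f , _ , f∈K = chooseFrom 1≤K in f zero , f∈K zero

  injective⇒≤size : ∀ {l} (f : Fin l → Fin n) → Injective _≡_ _≡_ f → (∀ a → f a ∈ K) → l ≤ size K
  injective⇒≤size {l} f f-injective f∈K = subst (l ≤_) count-tabulate (Fin.injective⇒≤ {f = position} λ {a} {b} eq →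
    f-injective (trans (sym (proj₂ (preimage a))) (trans (cong (select (tabulate K)) eq) (proj₂ (preimage b)))))
    where
    preimage : ∀ a → ∃ λ j → select (tabulate K) j ≡ f a
    preimage a = select-surjective (tabulate K) (∈-tabulate⁺ {K = K} (f∈K a))
    position : Fin l → Fin (count (tabulate K))
    position a = proj₁ (preimage a)

weight-↾ : ∀ {n} (w : Fin n → ℕ) (S K : Sub n) → weight (w ↾ S) K ≤ weight w (K ∩ S)
weight-↾ w S K = sum-mono-≤ pointwise
  where
  pointwise : ∀ i → ((w ↾ S) ↾ K) i ≤ (w ↾ (K ∩ S)) i
  pointwise i with K i
  ... | true  = ≤-refl
  ... | false = z≤n

abstract
  image : ∀ {m n} → (Fin m → Fin n) → Sub n
  image g = comprehension λ i → any? λ a → g a Fin.≟ i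

  image⁺ : ∀ {m n} (g : Fin m → Fin n) a → g a ∈ image g
  image⁺ g a = ∈-comprehension⁺ (λ i → any? λ a → g a Fin.≟ i) (a , refl)

  image⁻ : ∀ {m n} (g : Fin m → Fin n) {i} → i ∈ image g → ∃ λ a → g a ≡ i
  image⁻ g {i} = ∈-comprehension⁻ (λ i → any? λ a → g a Fin.≟ i) {i}

≤ᵢ-trans : ∀ {k m n} {F : Graph k} {H : Graph m} {G : Graph n} → F ≤ᵢ H → H ≤ᵢ G → F ≤ᵢ G
≤ᵢ-trans p q = record
  { emb = Q.emb ∘ P.emb ; emb-inj = P.emb-inj ∘ Q.emb-inj
  ; emb-adj = λ i j → trans (P.emb-adj i j) (Q.emb-adj (P.emb i) (P.emb j)) }
  where
  module P = _≤ᵢ_ p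
  module Q = _≤ᵢ_ q

hasClique-injective : ∀ {n k} {G : Graph n} ((f , _) : HasClique G k) → Injective _≡_ _≡_ f
hasClique-injective {G = G} (f , f-clique) {a} {b} eq with a Fin.≟ b
... | yes a≡b = a≡b
... | no a≢b  = contradiction (subst (λ x → adj G (f a) x ≡ true) (sym eq) (f-clique a b a≢b)) (∼-irr G)

module _ {n} (G : Graph n) where

  induce≤ᵢ : ∀ s → induce G s ≤ᵢ G
  induce≤ᵢ s = record { emb = select s ; emb-inj = select-injective s ; emb-adj = λ _ _ → refl }

  clique⇒hasClique : ∀ {K t} → Clique G K → t ≤ size K → HasClique G t
  clique⇒hasClique {K} cK t≤K with chooseFrom K t≤K
  ... | f , f-injective , f∈K = f , λ a b a≢b → cK (f∈K a) (f∈K b) (a≢b ∘ f-injective)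

  hasClique⇒clique : ∀ {t} ((f , _) : HasClique G t) → Clique G (image f) × t ≤ size (image f)
  hasClique⇒clique hc@(f , f-clique) = cl , injective⇒≤size (image f) f (hasClique-injective {G = G} hc) (image⁺ f)
    where
    cl : Clique G (image f)
    cl {i} {j} i∈ j∈ i≢j with image⁻ f {i} i∈ | image⁻ f {j} j∈
    ... | a , refl | b , refl = f-clique a b λ { refl → i≢j refl }

  -- The weight that is one on the image of `H` and zero elsewhere singles out the induced subgraph,
  -- and each of its vertices may keep any one of its colours.
  weightPerfect⇒perfect : ∀ s → WeightPerfect G (lookup s) → Perfect (induce G s)
  weightPerfect⇒perfect s perfect {m} H H≤ k (hasClique , noLarger) = colouring , optimal
    where
    open _≤ᵢ_ (≤ᵢ-trans H≤ (induce≤ᵢ s))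
    w : Fin n → ℕ
    w = (λ _ → 1) ↾ image emb

    emb∈ : ∀ a → emb a ∈ lookup s
    emb∈ a = select-∈ s _

    bound : ∀ K → Clique G K → K ⊆ lookup s → weight w K ≤ k
    bound K cK _ = ≮⇒≥ λ k<K → noLarger (pull (≤-trans k<K (weight-↾ (λ _ → 1) (image emb) K)))
      where
      pull : suc k ≤ size (K ∩ image emb) → HasClique H (suc k)
      pull k<K with chooseFrom (K ∩ image emb) k<K
      ... | f , f-injective , f∈ = g , λ a b a≢b → trans (emb-adj (g a) (g b))
              (subst₂ (λ x y → adj G x y ≡ true) (sym (proj₂ (preimage a))) (sym (proj₂ (preimage b)))
                (cK (proj₁ (split a)) (proj₁ (split b)) (a≢b ∘ f-injective)))
        where
        split : ∀ a → f a ∈ K × f a ∈ image emb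
        split a = ∩⁻ {S = K} {image emb} {f a} (f∈ a)
        preimage : ∀ a → ∃ λ x → emb x ≡ f a
        preimage a = image⁻ emb (proj₂ (split a))
        g : Fin (suc k) → Fin m
        g a = proj₁ (preimage a)

    multicolouring : Multicolouring G (lookup s) w k
    multicolouring = perfect w k bound

    enough : ∀ a → 1 ≤ size (proj₁ multicolouring (emb a))
    enough a = subst (_≤ size (proj₁ multicolouring (emb a))) (↾-∈ (λ _ → 1) {image emb} (image⁺ emb a))
                 (proj₁ (proj₂ multicolouring) (emb a) (emb∈ a))

    colour : ∀ a → ∃ λ c → c ∈ proj₁ multicolouring (emb a)
    colour a = inhabitant (proj₁ multicolouring (emb a)) (enough a)

    colouring : Colorable H k
    colouring = (proj₁ ∘ colour) , λ a b ab eq →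
      proj₂ (proj₂ multicolouring) (emb∈ a) (emb∈ b) (trans (sym (emb-adj a b)) ab)
        (proj₂ (colour a)) (subst (_∈ proj₁ multicolouring (emb b)) (sym eq) (proj₂ (colour b)))

    optimal : ∀ j → Colorable H j → k ≤ j
    optimal j (c , proper) = Fin.injective⇒≤ {f = c ∘ proj₁ hasClique} λ {a} {b} eq →
      decidable-stable (a Fin.≟ b) λ a≢b → proper _ _ (proj₂ hasClique a b a≢b) eq

  weightDivision⇒division : WeightDivision G (λ _ → true) (λ _ → 1) → Σ (Vec Bool n) λ s →
    Perfect (induce G s) ×
    (∀ k l → IsCliqueNumber G k → IsCliqueNumber (induce G (Vec.map not s)) l → l < k)
  weightDivision⇒division division = s , weightPerfect⇒perfect s
      (weightPerfect-cong G (λ {i} → ∈-tabulate⁺ {K = A} {i}) (λ {i} → ∈-tabulate⁻ {K = A} {i}) A-perfect) , smaller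
    where
    open WeightDivision division
    s = tabulate A
    s̄ = Vec.map not s
    avoids : ∀ i → i ∈ lookup s̄ → i ∉ A
    avoids i i∈ i∈A with trans (sym (lookup-map i not s)) i∈
    ... | eq rewrite ∈-tabulate⁺ {K = A} {i} i∈A with eq
    ...   | ()
    smaller : ∀ k l → IsCliqueNumber G k → IsCliqueNumber (induce G s̄) l → l < k
    smaller k l (_ , noLarger) ((f , f-clique) , _) with hasClique⇒clique (select s̄ ∘ f , f-clique)
    ... | cK , l≤K with dominate (image (select s̄ ∘ f)) cK (λ _ → refl) inB
      where
      inB : ∀ {i} → i ∈ image (select s̄ ∘ f) → i ∉ A
      inB {i} i∈ with image⁻ (select s̄ ∘ f) {i} i∈
      ... | a , refl = avoids _ (select-∈ s̄ (f a))
    ...   | dominated L cL _ K<L = ≰⇒> λ k≤l →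
            noLarger (clique⇒hasClique {L} cL (≤-trans (s≤s k≤l) (≤-trans (s≤s l≤K) K<L)))

-- Forbidden subgraphs from explicit adjacencies

-- One component for each pair `i`, `j` with `i` below `j`; for a concrete `k` this computes to a
-- plain tuple.
Pairs : ∀ k → (Fin k → Fin k → Set) → Set
Row   : ∀ k → (Fin k → Set) → Set → Set
Row zero    P R = R
Row (suc k) P R = P zero × Row k (P ∘ suc) R
Pairs zero    R = ⊤
Pairs (suc k) R = Row k (R zero ∘ suc) (Pairs k λ i j → R (suc i) (suc j))

Row-head : ∀ k {P R} → Row k P R → ∀ i → P i
Row-head (suc k) (p , r) zero    = p
Row-head (suc k) (p , r) (suc i) = Row-head k r i

Row-rest : ∀ k {P R} → Row k P R → R
Row-rest zero    r       = r
Row-rest (suc k) (_ , r) = Row-rest k r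

pair : ∀ k {R : Fin k → Fin k → Set} → (∀ {i j} → R i j → R j i) → Pairs k R → ∀ i j → i ≢ j → R i j
pair (suc k) R-sym ps zero    zero    i≢j = contradiction refl i≢j
pair (suc k) R-sym ps zero    (suc j) _   = Row-head k ps j
pair (suc k) R-sym ps (suc i) zero    _   = R-sym (Row-head k ps i)
pair (suc k) {R} R-sym ps (suc i) (suc j) i≢j =
  pair k {λ i j → R (suc i) (suc j)} R-sym (Row-rest k ps) i j (i≢j ∘ cong suc)

module _ {k n} (F : Graph k) (G : Graph n) (e : Fin k → Fin n) where

  Agreement : Set
  Agreement = Pairs k (λ i j → adj F i j ≡ adj G (e i) (e j))

  agreement : Agreement → ∀ i j → adj F i j ≡ adj G (e i) (e j)
  agreement ps i j with i Fin.≟ j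
  ... | yes refl = trans (adj-irr F i) (sym (adj-irr G (e i)))
  ... | no i≢j = pair k {λ i j → adj F i j ≡ adj G (e i) (e j)}
                   (λ {i} {j} p → trans (adj-sym F j i) (trans p (adj-sym G (e i) (e j)))) ps i j i≢j

  -- A map preserving adjacency and non-adjacency can identify only twins.
  embed : (∀ i j → (∀ l → adj F i l ≡ adj F j l) → e i ≡ e j → i ≡ j) → Agreement → F ≤ᵢ G
  embed separates ps = record
    { emb = e ; emb-adj = agreement ps
    ; emb-inj = λ {i} {j} eq → separates i j (λ l → trans (agreement ps i l)
        (trans (cong (λ x → adj G x (e l)) eq) (sym (agreement ps j l)))) eq }

-- Holds for the bull, the house and the hammer, whose images are thus distinct automatically. The
-- diamond has one pair of twins, its two nonadjacent vertices.
twinFree? : ∀ {k} (F : Graph k) → Dec (∀ i j → (∀ l → adj F i l ≡ adj F j l) → i ≡ j)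
twinFree? F = all? λ i → all? λ j → all? (λ l → adj F i l Bool.≟ adj F j l) →-dec i Fin.≟ j

module _ {n} (G : Graph n) (S : Sub n) where
  private
    module H = Gr (subgraph G S)
    off : ∀ {a b} → ¬ adj G a b ≡ true → false ≡ adj G a b
    off n = sym (¬-not n)

  bullFree : Free bull G → H.BullFree
  bullFree free {a} {b} {c} {d} {e} ab ac bc ad be ¬cd ¬ce ¬ae ¬bd ¬de = free (embed bull G
    (lookup (proj₁ a ∷ proj₁ b ∷ proj₁ c ∷ proj₁ d ∷ proj₁ e ∷ [])) (λ i j twins _ → from-yes (twinFree? bull) i j twins)
    (sym ab , sym ac , sym ad , off ¬ae , sym bc , off ¬bd , sym be , off ¬cd , off ¬ce , off ¬de , tt))

  -- The complement of the house is the path b d r c a.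
  houseFree : Free house G → H.HouseFree
  houseFree free {a} {b} {c} {d} {r} ab bc cd da ra rb ¬ac ¬bd ¬rc ¬rd = free (embed house G
    (lookup (proj₁ b ∷ proj₁ d ∷ proj₁ r ∷ proj₁ c ∷ proj₁ a ∷ [])) (λ i j twins _ → from-yes (twinFree? house) i j twins)
    (off ¬bd , sym (∼-sym G rb) , sym bc , sym (∼-sym G ab) , off (¬rd ∘ ∼-sym G) , sym (∼-sym G cd) , sym da
    , off ¬rc , sym ra , off (¬ac ∘ ∼-sym G) , tt))

  hammerFree : Free hammer G → H.HammerFree
  hammerFree free {a} {b} {c} {d} {e} ab ac bc cd de ¬ad ¬bd ¬ae ¬be ¬ce = free (embed hammer G
    (lookup (proj₁ a ∷ proj₁ b ∷ proj₁ c ∷ proj₁ d ∷ proj₁ e ∷ [])) (λ i j twins _ → from-yes (twinFree? hammer) i j twins)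
    (sym ab , sym ac , off ¬ad , off ¬ae , sym bc , off ¬bd , off ¬be , sym cd , off ¬ce , sym de , tt))

  diamondFree : Free diamond G → H.DiamondFree
  diamondFree free {x} {y} {a} {b} ab xa xb ya yb x≢y ¬xy = free (embed diamond G e separates
    (off ¬xy , sym xa , sym xb , sym ya , sym yb , sym ab , tt))
    where
    e : Fin 4 → Fin n
    e = lookup (proj₁ x ∷ proj₁ y ∷ proj₁ a ∷ proj₁ b ∷ [])
    nonadjacentTwins : ∀ i j → (∀ l → adj diamond i l ≡ adj diamond j l) →
                       i ≡ j ⊎ (i ≡ zero × j ≡ suc zero) ⊎ (i ≡ suc zero × j ≡ zero)
    nonadjacentTwins = from-yes (all? λ i → all? λ j → all? (λ l → adj diamond i l Bool.≟ adj diamond j l) →-dec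
      (i Fin.≟ j ⊎-dec (i Fin.≟ zero ×-dec j Fin.≟ suc zero) ⊎-dec (i Fin.≟ suc zero ×-dec j Fin.≟ zero)))
    separates : ∀ i j → (∀ l → adj diamond i l ≡ adj diamond j l) → e i ≡ e j → i ≡ j
    separates i j twins eq with nonadjacentTwins i j twins
    ... | inj₁ i≡j                  = i≡j
    ... | inj₂ (inj₁ (refl , refl)) = contradiction (subgraph-≡ G {S} {x} {y} eq) x≢y
    ... | inj₂ (inj₂ (refl , refl)) = contradiction (subgraph-≡ G {S} {x} {y} (sym eq)) x≢y

-- Fat triangles and thin vertices

module _ {n} (G : Graph n) (S : Sub n) where
  private
    infix 4 _~_
    _~_ : Fin n → Fin n → Set
    i ~ j = adj G i j ≡ true
    _~?_ : ∀ i j → Dec (i ~ j)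
    i ~? j = adj G i j Bool.≟ true

  Extra : Fin n → Fin n → Fin n → Set
  Extra a b c = ∃ λ p → p ∈ S × p ~ a × p ≢ b × p ≢ c

  FatTriangle : Fin n → Fin n → Fin n → Set
  FatTriangle a b c =
    (a ∈ S × b ∈ S × c ∈ S) × (a ~ b × a ~ c × b ~ c) × (Extra a b c × Extra b a c × Extra c a b)

  extra? : ∀ a b c → Dec (Extra a b c)
  extra? a b c = any? λ p → p ∈? S ×-dec p ~? a ×-dec ¬? (p Fin.≟ b) ×-dec ¬? (p Fin.≟ c)

  fatTriangle? : Dec (∃ λ a → ∃ λ b → ∃ λ c → FatTriangle a b c)
  fatTriangle? = any? λ a → any? λ b → any? λ c →
    (a ∈? S ×-dec b ∈? S ×-dec c ∈? S) ×-dec (a ~? b ×-dec a ~? c ×-dec b ~? c) ×-dec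
    (extra? a b c ×-dec extra? b a c ×-dec extra? c a b)

  Thin : Fin n → Fin n → Fin n → Set
  Thin i a b = (a ∈ S × b ∈ S) × (i ~ a × i ~ b × a ~ b) × ¬ Extra i a b

  thin? : ∀ i → Dec (i ∈ S × ∃ λ a → ∃ λ b → Thin i a b)
  thin? i = i ∈? S ×-dec any? λ a → any? λ b →
    (a ∈? S ×-dec b ∈? S) ×-dec (i ~? a ×-dec i ~? b ×-dec a ~? b) ×-dec ¬? (extra? i a b)

  thin-swap : ∀ {i a b} → Thin i a b → Thin i b a
  thin-swap ((a∈ , b∈) , (ia , ib , ab) , ¬x) =
    (b∈ , a∈) , (ib , ia , ∼-sym G ab) , λ (p , p∈ , pi , p≢b , p≢a) → ¬x (p , p∈ , pi , p≢a , p≢b)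

  thin-neighbour : ∀ {i a b z} → Thin i a b → z ∈ S → z ~ i → z ≡ a ⊎ z ≡ b
  thin-neighbour {a = a} {b} {z} (_ , _ , ¬x) z∈ zi with z Fin.≟ a | z Fin.≟ b
  ... | yes z≡a | _       = inj₁ z≡a
  ... | no _    | yes z≡b = inj₂ z≡b
  ... | no z≢a  | no z≢b  = contradiction (z , z∈ , zi , z≢a , z≢b) ¬x

  module _ (prime : Gr.Prime (subgraph G S)) where

    -- Adjacent thin vertices `i`, `j` have the same single further neighbour `b`, so together they
    -- form a module.
    thin-nonadjacent′ : ∀ {i j b c d} → i ∈ S → j ∈ S → Thin i j b → Thin j c d → ⊥
    thin-nonadjacent′ {i} {j} {b} {c} {d} i∈ j∈ ti@((_ , b∈) , (ij , ib , jb) , _) tj =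
      prime (λ x → proj₁ x ≡ i ⊎ proj₁ x ≡ j) {i , i∈} {j , j∈} {b , b∈}
        (λ eq → ∼⇒≢ G ij (cong proj₁ eq)) (inj₁ refl) (inj₂ refl)
        (λ { (inj₁ b≡i) → ∼⇒≢ G ib (sym b≡i) ; (inj₂ b≡j) → ∼⇒≢ G jb (sym b≡j) })
        λ {z} {x} {y} → unmixed {z} {x} {y}
      where
      nbr-i : ∀ {z} → z ∈ S → z ~ i → z ≢ j → z ~ j
      nbr-i z∈ zi z≢j with thin-neighbour ti z∈ zi
      ... | inj₁ z≡j  = contradiction z≡j z≢j
      ... | inj₂ refl = ∼-sym G jb
      nbr-j : ∀ {z} → z ∈ S → z ~ j → z ≢ i → z ~ i
      nbr-j {z} z∈ zj z≢i with thin-neighbour tj z∈ zj | thin-neighbour tj i∈ ij | thin-neighbour tj b∈ (∼-sym G jb)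
      ... | inj₁ refl | inj₁ refl | _         = contradiction refl z≢i
      ... | inj₁ refl | inj₂ refl | inj₁ refl = ∼-sym G ib
      ... | inj₁ refl | inj₂ refl | inj₂ refl = contradiction ib (∼-irr G)
      ... | inj₂ refl | inj₂ refl | _         = contradiction refl z≢i
      ... | inj₂ refl | inj₁ refl | inj₂ refl = ∼-sym G ib
      ... | inj₂ refl | inj₁ refl | inj₁ refl = contradiction ib (∼-irr G)
      unmixed : Gr.Unmixed (subgraph G S) (λ x → proj₁ x ≡ i ⊎ proj₁ x ≡ j)
      unmixed ¬z (inj₁ refl) (inj₁ refl) zx ¬zy = ¬zy zx
      unmixed {z , z∈} ¬z (inj₁ refl) (inj₂ refl) zx ¬zy = ¬zy (nbr-i z∈ zx (¬z ∘ inj₂))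
      unmixed {z , z∈} ¬z (inj₂ refl) (inj₁ refl) zx ¬zy = ¬zy (nbr-j z∈ zx (¬z ∘ inj₁))
      unmixed ¬z (inj₂ refl) (inj₂ refl) zx ¬zy = ¬zy zx

    thin-nonadjacent : ∀ {i j a b c d} → i ∈ S → j ∈ S → j ~ i → Thin i a b → Thin j c d → ⊥
    thin-nonadjacent i∈ j∈ ji ti tj with thin-neighbour ti j∈ ji
    ... | inj₁ refl = thin-nonadjacent′ i∈ j∈ ti tj
    ... | inj₂ refl = thin-nonadjacent′ i∈ j∈ (thin-swap ti) tj

  thick : Sub n
  thick = S ∖ comprehension thin?

  -- A vertex of such a triangle is not thin, so it has a neighbour in `S` outside the triangle, and
  -- the triangle is fat.
  noThickTriangle : ¬ (∃ λ a → ∃ λ b → ∃ λ c → FatTriangle a b c) → TriangleFree (induce G (tabulate thick))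
  noThickTriangle noFat Δ = noFat (a , b , c , (inS zero , inS one , inS two) , (ab , ac , bc) ,
      ( extra zero b c (inS one) (inS two) ab ac bc
      , extra one a c (inS zero) (inS two) (∼-sym G ab) bc ac
      , extra two a b (inS zero) (inS one) (∼-sym G ac) (∼-sym G bc) ab))
    where
    open _≤ᵢ_ Δ
    one two : Fin 3
    one = suc zero
    two = suc (suc zero)
    vertex : Fin 3 → Fin n
    vertex t = select (tabulate thick) (emb t)
    a = vertex zero
    b = vertex one
    c = vertex two
    ab : a ~ b
    ab = sym (emb-adj zero one)
    ac : a ~ c
    ac = sym (emb-adj zero two)
    bc : b ~ c
    bc = sym (emb-adj one two)
    inThick : ∀ t → vertex t ∈ S × vertex t ∉ comprehension thin?
    inThick t = ∖⁻ {S = S} {comprehension thin?} {vertex t}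
      (∈-tabulate⁻ {K = thick} (select-∈ (tabulate thick) (emb t)))
    inS : ∀ t → vertex t ∈ S
    inS t = proj₁ (inThick t)
    extra : ∀ t x y → x ∈ S → y ∈ S → vertex t ~ x → vertex t ~ y → x ~ y → Extra (vertex t) x y
    extra t x y x∈ y∈ tx ty xy = decidable-stable (extra? (vertex t) x y) λ ¬extra →
      proj₂ (inThick t) (∈-comprehension⁺ thin? {vertex t} (inS t , x , y , (x∈ , y∈) , (tx , ty , xy) , ¬extra))

  -- A thin vertex is coloured after its two neighbours, neither of which is thin.
  extendColouring : Gr.Prime (subgraph G S) → Colorable (induce G (tabulate thick)) 3 → ∃ (ProperOn G S)
  extendColouring prime (c , c-proper) = colour , proper
    where
    s = tabulate thick
    position : ∀ {i} → i ∈ thick → ∃ λ j → select s j ≡ i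
    position i∈ = select-surjective s (∈-tabulate⁺ {K = thick} i∈)

    base : Fin n → Fin 3
    base i with i ∈? thick
    ... | yes i∈ = c (proj₁ (position i∈))
    ... | no _   = zero

    base-proper : ∀ {i j} → i ∈ thick → j ∈ thick → i ~ j → base i ≢ base j
    base-proper {i} {j} i∈ j∈ ij with i ∈? thick | j ∈? thick
    ... | no i∉   | _       = contradiction i∈ i∉
    ... | yes _   | no j∉   = contradiction j∈ j∉
    ... | yes i∈′ | yes j∈′ = c-proper _ _
            (subst₂ _~_ (sym (proj₂ (position i∈′))) (sym (proj₂ (position j∈′))) ij)

    third : Fin 3 → Fin 3 → Fin 3
    third zero          zero          = suc zero
    third zero          (suc zero)    = suc (suc zero)
    third zero          (suc (suc _)) = suc zero
    third (suc zero)    zero          = suc (suc zero)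
    third (suc zero)    (suc _)       = zero
    third (suc (suc _)) zero          = suc zero
    third (suc (suc _)) (suc _)       = zero

    third≢ : ∀ x y → third x y ≢ x × third x y ≢ y
    third≢ = from-yes (all? λ x → all? λ y → ¬? (third x y Fin.≟ x) ×-dec ¬? (third x y Fin.≟ y))

    colour : Fin n → Fin 3
    colour i with thin? i
    ... | yes (_ , a , b , _) = third (base a) (base b)
    ... | no _                = base i

    thick-intro : ∀ {i} → i ∈ S → ¬ (i ∈ S × ∃ λ a → ∃ λ b → Thin i a b) → i ∈ thick
    thick-intro {i} i∈ ¬thin = ∖⁺ {S = S} {comprehension thin?} i∈ (¬thin ∘ ∈-comprehension⁻ thin? {i})

    third-differs : ∀ {i a b z} → Thin i a b → z ∈ S → z ~ i → third (base a) (base b) ≢ base z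
    third-differs {a = a} {b} ti z∈ zi with thin-neighbour ti z∈ zi
    ... | inj₁ refl = proj₁ (third≢ (base a) (base b))
    ... | inj₂ refl = proj₂ (third≢ (base a) (base b))

    proper : ProperOn G S colour
    proper {i} {j} i∈ j∈ ij with thin? i | thin? j
    ... | no ¬ti             | no ¬tj             = base-proper (thick-intro i∈ ¬ti) (thick-intro j∈ ¬tj) ij
    ... | yes (_ , _ , _ , ti) | no _             = third-differs ti j∈ (∼-sym G ij)
    ... | no _               | yes (_ , _ , _ , tj) = third-differs tj i∈ ij ∘ sym
    ... | yes (_ , _ , _ , ti) | yes (_ , _ , _ , tj) =
          ⊥-elim (thin-nonadjacent prime i∈ j∈ (∼-sym G ij) ti tj)

  anticentreOfFatTriangle : ∀ h → BullHFree h G → Gr.Prime (subgraph G S) → ∀ {a b c} → FatTriangle a b c →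
    NoPrimeNonBipartite G (comprehension (λ i → i ∈? S ×-dec ¬? (adj G i a Bool.≟ true)))
  anticentreOfFatTriangle h (noBull , noH) prG {a} {b} {c}
    ((a∈ , b∈ , c∈) , (ab , ac , bc) , ((p , p∈ , pa , p≢b , p≢c) , (q , q∈ , qb , q≢a , q≢c) , (r , r∈ , rc , r≢a , r≢b)))
    F F⊆ prI nbI = conclude h noH
    where
    P? = λ i → i ∈? S ×-dec ¬? (adj G i a Bool.≟ true)
    F⊆S : F ⊆ S
    F⊆S {i} i∈ = proj₁ (∈-comprehension⁻ P? {i} (F⊆ i∈))
    φ = inclusion G {S} {F} (λ {i} → F⊆S {i})
    module H = Gr (subgraph G S)
    A B C : H.V
    A = a , a∈
    B = b , b∈
    C = c , c∈
    anti : ∀ i → ¬ _↪_.to φ i H.~ A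
    anti (i , i∈) = proj₂ (∈-comprehension⁻ P? {i} (F⊆ i∈))
    conclude : ∀ h → Free (hGraph h) G → ⊥
    conclude isHouse noH = houseAnti φ prG (λ {x} {y} {z} {v} {w} → bullFree G S noBull {x} {y} {z} {v} {w})
      (λ {x} {y} {z} {v} {w} → houseFree G S noH {x} {y} {z} {v} {w}) prI nbI {A} {B} {C} ab ac bc anti
    conclude isHammer noH = hammerAnti φ prG (λ {x} {y} {z} {v} {w} → bullFree G S noBull {x} {y} {z} {v} {w})
      (λ {x} {y} {z} {v} {w} → hammerFree G S noH {x} {y} {z} {v} {w}) prI nbI
      (H.prime⇒connected prG (H.triangle⇒nonBipartite {A} {B} {C} ab ac bc)) {A} {B} {C} ab ac bc anti
    conclude isDiamond noH = diamondAnti φ prG (λ {x} {y} {z} {v} {w} → bullFree G S noBull {x} {y} {z} {v} {w})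
      (λ {x} {y} {z} {v} → diamondFree G S noH {x} {y} {z} {v}) prI nbI
      (λ eq → subgraph-≡ G (cong proj₁ eq)) {A} {B} {C} {p , p∈} {q , q∈} {r , r∈} ab ac bc
      pa (p≢b ∘ cong proj₁) (p≢c ∘ cong proj₁) qb (q≢a ∘ cong proj₁) (q≢c ∘ cong proj₁)
      rc (r≢a ∘ cong proj₁) (r≢b ∘ cong proj₁) anti

theorem5 : (h : HChoice) → PerfectPollyanna (BullHFree h)
theorem5 h 𝒢 hereditary 3-colourable G (noBull , noH) G∈𝒢 {suc m} H H≤G _ =
  weightDivision⇒division H (weightDivision H primeCase (λ _ → true) {zero} refl (λ _ → 1) (λ _ → s≤s z≤n))
  where
  H-free : BullHFree h H
  H-free = (λ bull≤H → noBull (≤ᵢ-trans bull≤H H≤G)) , (λ F≤H → noH (≤ᵢ-trans F≤H H≤G))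

  primeCase : ∀ S {s} → s ∈ S → Gr.Prime (subgraph H S) → ∀ w → (∀ i → 0 < w i) → WeightDivision H S w
  primeCase S s∈S prime w w>0 with fatTriangle? H S
  ... | yes (a , b , c , fat) = divideByAnticentre H w w>0 (proj₁ (proj₁ fat))
          (noPrimeNonBipartite⇒weightPerfect H _ (anticentreOfFatTriangle H S h H-free prime fat))
  ... | no noFat =
    -- The thick part is induced in `G`, hence a triangle-free member of `𝒢`.
    let K = induce H (tabulate (thick H S))
        c , proper = extendColouring H S prime (3-colourable K
          (hereditary K G (≤ᵢ-trans (induce≤ᵢ H (tabulate (thick H S))) H≤G) G∈𝒢) (noThickTriangle H S noFat))
    in divideByColouring H w w>0 s∈S c proper
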